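{- For every natural number $m$ and every model $\mathfrak{A}$ of Presburger Arithmetic $\mathrm{PrA}$ that is $m$-dimensionally interpreted in $(\mathbb{N},+)$, the model $\mathfrak{A}$ is isomorphic to $(\mathbb{N},+)$.
   Context: $\mathrm{PrA}$ is the first-order theory of $(\mathbb{N},+)$. An $m$-dimensional translation $\iota$ from signature $\{=,+\}$ to signature $\{=,+\}$ consists of formulas $\mathit{Dom}_\iota(\bar y)$, $\mathit{Pred}_{\iota,=}(\bar y_1,\bar y_2)$, $\mathit{Fun}_{\iota,+}(\bar y_0,\bar y_1,\bar y_2)$ over $\{=,+\}$, each $\bar y_i$ an $m$-tuple of variables. It is an interpretation of a structure $\mathfrak{A}=(A,+^{\mathfrak{A}})$ in $(\mathbb{N},+)$ if $\mathit{Dom}_\iota$ defines a nonempty $D\subseteq\mathbb{N}^m$, $\mathit{Pred}_{\iota,=}$ defines an equivalence relation $\sim$ on $D$, and there is a bijection $h:D/{\sim}\to A$ such that for all $\bar b_0,\bar b_1,\bar b_2\in D$: $h([\bar b_0])=h([\bar b_1])+^{\mathfrak{A}}h([\bar b_2])$ iff $(\mathbb{N},+)\models\mathit{Fun}_{\iota,+}(\bar b_0,\bar b_1,\bar b_2)$. $\mathfrak{A}$ is $m$-dimensionally interpreted in $(\mathbb{N},+)$ if such an $\iota$ exists. -}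

module Defs where

open import Data.Nat using (ℕ; suc) renaming (_+_ to _+ℕ_)
open import Data.Fin using (Fin)
open import Data.Product using (Σ; _×_; ∃)
open import Data.Empty using (⊥)
open import Relation.Nullary using (¬_)
open import Relation.Binary.PropositionalEquality using (_≡_)
open import Data.Vec.Functional using (Vector; _∷_; _++_)
open import Function.Bundles using (_⇔_)

data Term (n : ℕ) : Set where
  var  : Fin n → Term n
  _⊕ₜ_ : Term n → Term n → Term n

-- Primitive connectives: =, ¬, ∧, ∀ (classically complete; ∃, ∨, → are abbreviations).
data Formula (n : ℕ) : Set where
  _≐_  : Term n → Term n → Formula n
  ¬ᶠ_  : Formula n → Formula n
  _∧ᶠ_ : Formula n → Formula n → Formula n
  ∀ᶠ   : Formula (suc n) → Formula n

∃ᶠ : ∀ {n} → Formula (suc n) → Formula n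
∃ᶠ φ = ¬ᶠ ∀ᶠ (¬ᶠ φ)

Sentence : Set
Sentence = Formula 0

record Structure : Set₁ where
  field
    Carrier : Set
    _⊕_     : Carrier → Carrier → Carrier

ℕ-str : Structure
ℕ-str = record { Carrier = ℕ ; _⊕_ = _+ℕ_ }

module _ (𝔄 : Structure) where
  open Structure 𝔄

  ⟦_⟧ₜ : ∀ {n} → Term n → Vector Carrier n → Carrier
  ⟦ var i ⟧ₜ ρ = ρ i
  ⟦ s ⊕ₜ t ⟧ₜ ρ = ⟦ s ⟧ₜ ρ ⊕ ⟦ t ⟧ₜ ρ

  Sat : ∀ {n} → Formula n → Vector Carrier n → Set
  Sat (s ≐ t) ρ = ⟦ s ⟧ₜ ρ ≡ ⟦ t ⟧ₜ ρ
  Sat (¬ᶠ φ) ρ = ¬ Sat φ ρ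
  Sat (φ ∧ᶠ ψ) ρ = Sat φ ρ × Sat ψ ρ
  Sat (∀ᶠ φ) ρ = (a : Carrier) → Sat φ (a ∷ ρ)

_⊨_[_] : (𝔄 : Structure) → ∀ {n} → Formula n → Vector (Structure.Carrier 𝔄) n → Set
𝔄 ⊨ φ [ ρ ] = Sat 𝔄 φ ρ

_⊨ˢ_ : Structure → Sentence → Set
𝔄 ⊨ˢ φ = 𝔄 ⊨ φ [ (λ ()) ]

-- PrA = Th(ℕ,+); 𝔄 is a model of PrA iff it satisfies every sentence true in (ℕ,+)
ModelOfPrA : Structure → Set
ModelOfPrA 𝔄 = (φ : Sentence) → ℕ-str ⊨ˢ φ → 𝔄 ⊨ˢ φ

record Translation (m : ℕ) : Set where
  field
    Dom  : Formula m
    PredEq : Formula (m +ℕ m)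
    FunPlus : Formula (m +ℕ (m +ℕ m))

-- ι is an interpretation of 𝔄 in (ℕ,+).  The bijection h : D/∼ → A is
-- represented (no quotient types) as a map h on D whose kernel is exactly ∼
-- (well-defined and injective on classes) and which is surjective.
record IsInterpretation {m : ℕ} (ι : Translation m) (𝔄 : Structure) : Set where
  open Translation ι
  open Structure 𝔄
  D : Vector ℕ m → Set
  D b = ℕ-str ⊨ Dom [ b ]
  _∼_ : Vector ℕ m → Vector ℕ m → Set
  b ∼ b' = ℕ-str ⊨ PredEq [ b ++ b' ]
  field
    nonempty : Σ (Vector ℕ m) D
    ∼-refl  : ∀ b → D b → b ∼ b
    ∼-sym   : ∀ b b' → D b → D b' → b ∼ b' → b' ∼ b
    ∼-trans : ∀ b b' b'' → D b → D b' → D b'' → b ∼ b' → b' ∼ b'' → b ∼ b''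
    h       : (b : Vector ℕ m) → D b → Carrier
    h-kernel : ∀ b b' (d : D b) (d' : D b') → (h b d ≡ h b' d') ⇔ (b ∼ b')
    h-surj  : ∀ (a : Carrier) → Σ (Vector ℕ m) λ b → Σ (D b) λ d → h b d ≡ a
    h-plus  : ∀ b₀ b₁ b₂ (d₀ : D b₀) (d₁ : D b₁) (d₂ : D b₂) →
              (h b₀ d₀ ≡ h b₁ d₁ ⊕ h b₂ d₂) ⇔ (ℕ-str ⊨ FunPlus [ b₀ ++ (b₁ ++ b₂) ])

InterpretedIn-ℕ : ℕ → Structure → Set
InterpretedIn-ℕ m 𝔄 = Σ (Translation m) λ ι → IsInterpretation ι 𝔄

record _≅_ (𝔄 𝔅 : Structure) : Set where
  open Structure 𝔄 renaming (Carrier to A; _⊕_ to _⊕ᴬ_)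
  open Structure 𝔅 renaming (Carrier to B; _⊕_ to _⊕ᴮ_)
  field
    to      : A → B
    from    : B → A
    from-to : ∀ a → from (to a) ≡ a
    to-from : ∀ b → to (from b) ≡ b
    to-hom  : ∀ x y → to (x ⊕ᴬ y) ≡ to x ⊕ᴮ to y

{-# OPTIONS --safe #-}
-- Truth of a Presburger formula depends only on the signs of linear forms with bounded
-- coefficients and on residues, by a back-and-forth argument. Hence every formula is decidable,
-- its witnesses are linearly bounded, and its one-variable sections are eventually periodic;
-- the same then holds for formulas that also quantify over an interpreted structure and speak
-- about the norm (largest entry) of representatives.
--
-- Let a be an element of an interpreted model. Call x wide if the interval [0 , a] is covered,
-- up to gaps x, by the finitely many elements of some bounded norm. If 0 is wide, a is standard
-- by the pigeonhole principle. Otherwise let f N be the least wide element of norm at most N.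
-- The numbers N at which f drops by a wide amount form a definable infinite set, which has
-- bounded gaps, while each drop between N and 2N has norm at most c N and so is at least f (c N).
-- Hence k f (c N) ≤ f N for every k and all large N: f decays faster than any power of N.
-- But [0 , a] is covered up to gaps f N by elements of norm linear in N, of which there are
-- polynomially many; this is a contradiction.
module Submission where

open import Defs
open import Data.Nat using (ℕ)
open import Data.Product using (_,_)

-- Lists of all vectors over a finite alphabet.

module Enumeration where

  open import Data.Fin using (zero; suc)
  open import Data.List using (List; []; _∷_; length; map; cartesianProductWith)
  open import Data.List.Properties using (length-++; length-map)
  open import Data.List.Membership.Propositional using (_∈_)
  open import Data.List.Membership.Propositional.Properties using (∈-cartesianProductWith⁺)
  open import Data.List.Relation.Unary.Any using (here)
  open import Data.Nat using (ℕ; zero; suc; _+_; _*_; _^_)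
  open import Data.Product using (Σ; _×_; _,_)
  open import Data.Vec.Functional using (Vector) renaming (_∷_ to _∷ᵛ_)
  open import Function using (_∘_)
  open import Relation.Binary.PropositionalEquality

  vectors : ∀ {X : Set} → List X → ∀ n → List (Vector X n)
  vectors xs zero    = (λ ()) ∷ []
  vectors xs (suc n) = cartesianProductWith _∷ᵛ_ xs (vectors xs n)

  length-cartesianProductWith : ∀ {X Y Z : Set} (f : X → Y → Z) xs ys →
                                length (cartesianProductWith f xs ys) ≡ length xs * length ys
  length-cartesianProductWith f []       ys = refl
  length-cartesianProductWith f (x ∷ xs) ys =
    trans (length-++ (map (f x) ys))
          (cong₂ _+_ (length-map (f x) ys) (length-cartesianProductWith f xs ys))

  length-vectors : ∀ {X : Set} (xs : List X) n → length (vectors xs n) ≡ length xs ^ n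
  length-vectors xs zero    = refl
  length-vectors xs (suc n) =
    trans (length-cartesianProductWith _∷ᵛ_ xs (vectors xs n))
          (cong (length xs *_) (length-vectors xs n))

  -- Vectors are functions, whose propositional equality is not extensional, so the list is only
  -- claimed to contain a pointwise equal copy of `f`.
  vectors-complete : ∀ {X : Set} (xs : List X) {n} (f : Vector X n) → (∀ i → f i ∈ xs) →
                     Σ (Vector X n) λ g → g ∈ vectors xs n × f ≗ g
  vectors-complete xs {zero}  f f∈ = (λ ()) , here refl , λ ()
  vectors-complete xs {suc n} f f∈ =
    let g , g∈ , f≗g = vectors-complete xs (f ∘ suc) (f∈ ∘ suc)
    in f zero ∷ᵛ g , ∈-cartesianProductWith⁺ _∷ᵛ_ (f∈ zero) g∈
       , λ { zero → refl ; (suc i) → f≗g i }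

-- Integer linear forms evaluated at natural numbers.

module LinearForms where

  open import Data.Fin using (zero; suc)
  open import Data.Integer hiding (suc)
  open import Data.Integer.Properties
  open import Data.Integer.Tactic.RingSolver using (solve-∀)
  open import Data.Nat as ℕ using (ℕ; zero; suc)
  import Data.Nat.Properties as ℕ
  open import Data.Vec.Functional using (Vector)
  open import Function using (_∘_)
  open import Relation.Nullary using (¬_)
  open import Relation.Binary.PropositionalEquality

  0≤+ : ∀ n → 0ℤ ≤ + n
  0≤+ n = +≤+ ℕ.z≤n

  0≤-+ : ∀ {u v} → 0ℤ ≤ u → 0ℤ ≤ v → 0ℤ ≤ u + v
  0≤-+ = +-mono-≤

  0≤-subst : ∀ {u v} → u ≡ v → 0ℤ ≤ u → 0ℤ ≤ v
  0≤-subst = subst (0ℤ ≤_)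

  -- Integrality turns a failed inequality into another one of the form `0ℤ ≤ _`, so sign conditions
  -- are closed under complement at the cost of 1 in the constant.
  ¬0≤⇒0≤-u-1 : ∀ {u} → ¬ (0ℤ ≤ u) → 0ℤ ≤ - u + -1ℤ
  ¬0≤⇒0≤-u-1 {u} ¬p = 0≤-subst (eq u) (i≤j⇒0≤j-i (i<j⇒suc[i]≤j (≰⇒> ¬p)))
    where eq : ∀ u → 0ℤ - (1ℤ + u) ≡ - u + -1ℤ
          eq = solve-∀

  0≤⇒¬0≤-u-1 : ∀ {u} → 0ℤ ≤ u → ¬ (0ℤ ≤ - u + -1ℤ)
  0≤⇒¬0≤-u-1 {u} p q with 0≤-subst (eq u) (0≤-+ p q)
    where eq : ∀ u → u + (- u + -1ℤ) ≡ -1ℤ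
          eq = solve-∀
  ... | ()

  0≤+-∣∣ : ∀ u {n} → ∣ u ∣ ℕ.≤ n → 0ℤ ≤ + n + u
  0≤+-∣∣ (+ a)      {n} p = 0≤+ (n ℕ.+ a)
  0≤+-∣∣ -[1+ a ] {n} p rewrite ⊖-≥ p = 0≤+ (n ℕ.∸ suc a)

  ∣∣-≤ : ∀ u {n} → 0ℤ ≤ + n + u → 0ℤ ≤ + n - u → ∣ u ∣ ℕ.≤ n
  ∣∣-≤ (+ a)      {n} p q = drop‿+≤+ (0≤i-j⇒j≤i q)
  ∣∣-≤ -[1+ a ] {n} p q = drop‿+≤+ (0≤i-j⇒j≤i {+ n} {+ suc a} p)

  0≤-∣∣ : ∀ u {n} → ∣ u ∣ ℕ.≤ n → 0ℤ ≤ + n - u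
  0≤-∣∣ u p = 0≤+-∣∣ (- u) (ℕ.≤-trans (ℕ.≤-reflexive (∣-i∣≡∣i∣ u)) p)

  0≤-*-cancel : ∀ k {u} → .{{_ : ℕ.NonZero k}} → 0ℤ ≤ + k * u → 0ℤ ≤ u
  0≤-*-cancel (suc k) {u} p =
    *-cancelˡ-≤-pos 0ℤ u (+ suc k) (subst (_≤ + suc k * u) (sym (*-zeroʳ (+ suc k))) p)

  0≤-* : ∀ k {u} → 0ℤ ≤ u → 0ℤ ≤ + k * u
  0≤-* k {u} p = subst (_≤ + k * u) (*-zeroʳ (+ k)) (*-monoˡ-≤-nonNeg (+ k) p)

  sumᵛ : ∀ {n} → Vector ℕ n → ℕ
  sumᵛ {zero}  x = 0
  sumᵛ {suc n} x = x zero ℕ.+ sumᵛ (x ∘ suc)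

  dot : ∀ {n} → Vector ℤ n → Vector ℕ n → ℤ
  dot {zero}  c x = 0ℤ
  dot {suc n} c x = c zero * + x zero + dot (c ∘ suc) (x ∘ suc)

  dot-cong : ∀ {n} {c d : Vector ℤ n} (x : Vector ℕ n) → c ≗ d → dot c x ≡ dot d x
  dot-cong {zero}  x eq = refl
  dot-cong {suc n} x eq = cong₂ _+_ (cong (_* + x zero) (eq zero)) (dot-cong (x ∘ suc) (eq ∘ suc))

  dot-0 : ∀ {n} (x : Vector ℕ n) → dot (λ _ → 0ℤ) x ≡ 0ℤ
  dot-0 {zero}  x = refl
  dot-0 {suc n} x rewrite dot-0 (x ∘ suc) = refl

  dot-* : ∀ {n} k (c : Vector ℤ n) x → dot (λ i → k * c i) x ≡ k * dot c x
  dot-* {zero}  k c x = sym (*-zeroʳ k)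
  dot-* {suc n} k c x rewrite dot-* k (c ∘ suc) (x ∘ suc) = eq k (c zero) (+ x zero) _
    where eq : ∀ k c x d → k * c * x + k * d ≡ k * (c * x + d)
          eq = solve-∀

  dot-+ : ∀ {n} (c d : Vector ℤ n) x → dot (λ i → c i + d i) x ≡ dot c x + dot d x
  dot-+ {zero}  c d x = refl
  dot-+ {suc n} c d x rewrite dot-+ (c ∘ suc) (d ∘ suc) (x ∘ suc) = eq (c zero) (d zero) (+ x zero) _ _
    where eq : ∀ c d x s t → (c + d) * x + (s + t) ≡ c * x + s + (d * x + t)
          eq = solve-∀

  dot-neg : ∀ {n} (c : Vector ℤ n) x → dot (λ i → - c i) x ≡ - dot c x
  dot-neg {zero}  c x = refl
  dot-neg {suc n} c x rewrite dot-neg (c ∘ suc) (x ∘ suc) = eq (c zero) (+ x zero) _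
    where eq : ∀ c x s → (- c) * x + - s ≡ - (c * x + s)
          eq = solve-∀

  dot-minus : ∀ {n} (c d : Vector ℤ n) x → dot (λ i → c i - d i) x ≡ dot c x - dot d x
  dot-minus c d x = trans (dot-+ c (λ i → - d i) x) (cong (λ v → dot c x + v) (dot-neg d x))

  Bounded : ∀ {n} → ℕ → Vector ℤ n → Set
  Bounded K c = ∀ i → ∣ c i ∣ ℕ.≤ K

  dot-bound : ∀ {n} K (c : Vector ℤ n) x → Bounded K c → ∣ dot c x ∣ ℕ.≤ K ℕ.* sumᵛ x
  dot-bound {zero}  K c x b = ℕ.z≤n
  dot-bound {suc n} K c x b = begin
    ∣ c zero * + x zero + dot (c ∘ suc) (x ∘ suc) ∣
      ≤⟨ ∣i+j∣≤∣i∣+∣j∣ (c zero * + x zero) _ ⟩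
    ∣ c zero * + x zero ∣ ℕ.+ ∣ dot (c ∘ suc) (x ∘ suc) ∣
      ≤⟨ ℕ.+-mono-≤ (ℕ.≤-trans (ℕ.≤-reflexive (abs-* (c zero) (+ x zero))) (ℕ.*-monoˡ-≤ (x zero) (b zero)))
                    (dot-bound K (c ∘ suc) (x ∘ suc) (b ∘ suc)) ⟩
    K ℕ.* x zero ℕ.+ K ℕ.* sumᵛ (x ∘ suc)
      ≡⟨ ℕ.*-distribˡ-+ K (x zero) _ ⟨
    K ℕ.* sumᵛ x ∎
    where open ℕ.≤-Reasoning

  Bounded-* : ∀ {n} {K} k (c : Vector ℤ n) → Bounded K c → Bounded (∣ k ∣ ℕ.* K) (λ i → k * c i)
  Bounded-* k c b i = ℕ.≤-trans (ℕ.≤-reflexive (abs-* k (c i))) (ℕ.*-monoʳ-≤ ∣ k ∣ (b i))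

  Bounded-minus : ∀ {n} {K L} (c d : Vector ℤ n) → Bounded K c → Bounded L d →
              Bounded (K ℕ.+ L) (λ i → c i - d i)
  Bounded-minus c d b b' i =
    ℕ.≤-trans (∣i-j∣≤∣i∣+∣j∣ (c i) (d i)) (ℕ.+-mono-≤ (b i) (b' i))

-- Agreement of tuples on bounded linear forms and residues, and the answer to one move.

module Agreement where

  open Enumeration
  open LinearForms
  open import Data.Fin using (zero; suc)
  open import Data.Fin.Properties using (all?)
  open import Data.Integer hiding (suc; NonZero)
  open import Data.Integer.DivMod using (_%ℕ_; _/ℕ_; n%ℕd<d; a≡a%ℕn+[a/ℕn]*n)
  open import Data.Integer.Properties
  open import Data.Integer.Tactic.RingSolver using (solve-∀)
  open import Data.List as List using (List; filter; upTo)
  open import Data.List.Extrema ≤-totalOrder using (argmin; argmin-sel; f[argmin]≤f[xs])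
  open import Data.List.Membership.Propositional using (_∈_)
  open import Data.List.Membership.Propositional.Properties
    using (∈-filter⁺; ∈-filter⁻; ∈-map⁺; ∈-++⁺ˡ; ∈-++⁺ʳ; ∈-upTo⁺)
  open import Data.List.Relation.Unary.All as All using ()
  open import Data.Nat as ℕ using (ℕ; zero; suc; NonZero)
  import Data.Nat.Properties as ℕ
  open import Data.Product using (Σ; _×_; _,_; proj₁; proj₂)
  open import Data.Sum using (inj₁; inj₂)
  open import Data.Vec.Functional using (Vector)
  open import Function using (_∘_)
  open import Relation.Nullary using (Dec; yes; no; _×-dec_)
  open import Relation.Binary.PropositionalEquality

  _≡_mod_ : ℤ → ℤ → ℕ → Set
  u ≡ v mod L = Σ ℤ λ t → v ≡ u + t * + L

  mod-refl : ∀ {L} u → u ≡ u mod L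
  mod-refl {L} u = 0ℤ , sym (+-identityʳ u)

  mod-sym : ∀ {L u v} → u ≡ v mod L → v ≡ u mod L
  mod-sym {L} {u} (t , refl) = - t , eq u t (+ L)
    where eq : ∀ u t l → u ≡ u + t * l + (- t) * l
          eq = solve-∀

  mod-∣ : ∀ {L} u v q → u ≡ v mod (q ℕ.* L) → u ≡ v mod L
  mod-∣ {L} u v q (t , refl) = t * + q , cong (λ v → u + v)
    (trans (cong (t *_) (pos-* q L)) (sym (*-assoc t (+ q) (+ L))))

  SignsAgree : ∀ {n} → ℕ → ℕ → Vector ℕ n → Vector ℕ n → Set
  SignsAgree K E x y = ∀ c e → Bounded K c → ∣ e ∣ ℕ.≤ E → 0ℤ ≤ dot c x + e → 0ℤ ≤ dot c y + e

  -- The invariant of the back-and-forth game. It becomes finer as `K` and `E` grow and `L` is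
  -- replaced by a multiple.
  record Agree (K E L : ℕ) {n : ℕ} (x y : Vector ℕ n) : Set where
    constructor agree
    field
      signs  : SignsAgree K E x y
      signs˘ : SignsAgree K E y x
      mods   : ∀ i → (+ x i) ≡ (+ y i) mod L

  open Agree public

  Agree-refl : ∀ {K E L n} (x : Vector ℕ n) → Agree K E L x x
  Agree-refl x = agree (λ _ _ _ _ p → p) (λ _ _ _ _ p → p) (λ i → mod-refl _)

  Agree-sym : ∀ {K E L n} {x y : Vector ℕ n} → Agree K E L x y → Agree K E L y x
  Agree-sym (agree s s' m) = agree s' s (mod-sym ∘ m)

  Agree-mono : ∀ {K E L K' E'} q {n} {x y : Vector ℕ n} → K ℕ.≤ K' → E ℕ.≤ E' →
               Agree K' E' (q ℕ.* L) x y → Agree K E L x y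
  Agree-mono {L = L} q {x = x} {y} K≤ E≤ (agree s s' m) = agree
    (λ c e bc be → s c e (λ i → ℕ.≤-trans (bc i) K≤) (ℕ.≤-trans be E≤))
    (λ c e bc be → s' c e (λ i → ℕ.≤-trans (bc i) K≤) (ℕ.≤-trans be E≤))
    (λ i → mod-∣ {L} (+ x i) (+ y i) q (m i))

  dot-mod : ∀ {L n} (c : Vector ℤ n) {x y : Vector ℕ n} →
            (∀ i → (+ x i) ≡ (+ y i) mod L) → dot c x ≡ dot c y mod L
  dot-mod {n = zero}  c m = mod-refl 0ℤ
  dot-mod {L} {suc n} c {x} {y} m with m zero | dot-mod (c ∘ suc) (m ∘ suc)
  ... | t , p | s , q = c zero * t + s
      , trans (cong₂ (λ u v → c zero * u + v) p q) (eq (c zero) (+ x zero) t (+ L) _ s)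
    where eq : ∀ c x t l d s → c * (x + t * l) + (d + s * l) ≡ c * x + d + (c * t + s) * l
          eq = solve-∀

  private

    interval : ℕ → List ℤ
    interval K = List.map +_ (upTo (suc K)) List.++ List.map -[1+_] (upTo K)

    ∈-interval : ∀ {K} z → ∣ z ∣ ℕ.≤ K → z ∈ interval K
    ∈-interval (+ n)      p = ∈-++⁺ˡ (∈-map⁺ +_ (∈-upTo⁺ (ℕ.s≤s p)))
    ∈-interval {K} -[1+ n ] p = ∈-++⁺ʳ (List.map +_ (upTo (suc K))) (∈-map⁺ -[1+_] (∈-upTo⁺ p))

    -- The least value of u + dot c x above the cut-off -E, over bounded c.
    module Minimise {n} (K E : ℕ) (x : Vector ℕ n) (u : ℕ) where

      value : Vector ℤ n → ℤ
      value c = + u + dot c x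

      Good : Vector ℤ n → Set
      Good c = Bounded K c × 0ℤ ≤ value c + + E

      good? : ∀ c → Dec (Good c)
      good? c = all? (λ i → ∣ c i ∣ ℕ.≤? K) ×-dec 0ℤ ≤? value c + + E

      candidates : List (Vector ℤ n)
      candidates = filter good? (vectors (interval K) n)

      best : Vector ℤ n
      -- The zero vector is a legitimate default: its value is `u`, which is nonnegative and so
      -- above the cut-off.
      best = argmin value (λ _ → 0ℤ) candidates

      best-good : Good best
      best-good with argmin-sel value (λ _ → 0ℤ) candidates
      ... | inj₁ eq rewrite eq = (λ _ → ℕ.z≤n)
          , 0≤-subst (cong (λ v → + u + v + + E) (sym (dot-0 x))) (0≤+ (u ℕ.+ 0 ℕ.+ E))
      ... | inj₂ best∈ = proj₂ (∈-filter⁻ good? {xs = vectors (interval K) n} best∈)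

      best-least : ∀ c → Good c → value best ≤ value c
      best-least c (bc , gc) with vectors-complete (interval K) c (λ i → ∈-interval (c i) (bc i))
      ... | g , g∈ , c≗g = subst (value best ≤_) value≡
              (All.lookup (f[argmin]≤f[xs] (λ _ → 0ℤ) candidates)
                (∈-filter⁺ good? g∈
                  ( (λ i → subst (λ z → ∣ z ∣ ℕ.≤ K) (c≗g i) (bc i))
                  , 0≤-subst (cong (_+ + E) (sym value≡)) gc)))
        where value≡ : value g ≡ value c
              value≡ = cong (λ v → + u + v) (sym (dot-cong x c≗g))

  -- Given a beside x, the answer b beside y puts M b in the same position, relative to
  -- the greatest form - dot c x below M a (up to E), with large distances shrunk mod M L.
  module Respond {n} (K E M L : ℕ) .{{_ : NonZero M}} .{{_ : NonZero (M ℕ.* L)}}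
                 (x y : Vector ℕ n)
                 (ag : Agree (K ℕ.+ K) (E ℕ.+ E ℕ.+ M ℕ.* L ℕ.+ E) (M ℕ.* L) x y)
                 (a : ℕ) where

    P R : ℕ
    P = M ℕ.* L
    R = E ℕ.+ E ℕ.+ P

    open Minimise K E x (M ℕ.* a) renaming (best to c*)

    r : ℤ
    r = value c*

    c*-bounded : Bounded K c*
    c*-bounded = proj₁ best-good

    -- An offset `r` of at most `R` is kept. A larger one is replaced by a congruent value between
    -- `E` and `R - E`. That interval has length `P`, so it meets every residue class, and adding a
    -- constant of size at most `E` leads neither below 0 nor above `R`.
    data Position : Set where
      near : 0ℤ ≤ + R - r → Position
      far  : ∀ r' → r ≡ r' mod P → 0ℤ ≤ r - + R + -1ℤ → 0ℤ ≤ r' - + E → 0ℤ ≤ + R - + E - r' → Position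

    q m : ℤ
    q = (r - + E) /ℕ P
    m = + ((r - + E) %ℕ P)

    position : Position
    position with 0ℤ ≤? + R - r
    ... | yes p = near p
    ... | no ¬p = far (+ E + m) (- q , mod-eq)
                      (0≤-subst (far-eq (+ R) r) (¬0≤⇒0≤-u-1 ¬p))
                      (0≤-subst (lo-eq (+ E) m) (0≤+ ((r - + E) %ℕ P)))
                      (0≤-subst hi-eq (i≤j⇒0≤j-i (+≤+ (ℕ.<⇒≤ (n%ℕd<d (r - + E) P)))))
      where
      far-eq : ∀ R r → - (R - r) + -1ℤ ≡ r - R + -1ℤ
      far-eq = solve-∀
      lo-eq : ∀ E m → m ≡ E + m - E
      lo-eq = solve-∀
      mod-eq : + E + m ≡ r + (- q) * + P
      mod-eq = trans (eq₁ (+ E) m q (+ P))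
                     (trans (cong (λ v → + E + v - q * + P) (sym (a≡a%ℕn+[a/ℕn]*n (r - + E) P)))
                            (eq₂ (+ E) r q (+ P)))
        where
        eq₁ : ∀ E m q P → E + m ≡ E + (m + q * P) - q * P
        eq₁ = solve-∀
        eq₂ : ∀ E r q P → E + (r - E) - q * P ≡ r + (- q) * P
        eq₂ = solve-∀
      hi-eq : + P - m ≡ + R - + E - (+ E + m)
      hi-eq = eq (+ E) (+ P) m
        where eq : ∀ E P m → P - m ≡ E + E + P - E - (E + m)
              eq = solve-∀

    -E≤r : 0ℤ ≤ r + + E
    -E≤r = proj₂ best-good

    shifted : Vector ℤ n → Vector ℤ n
    shifted c i = c i - c* i

    r' : ℤ
    r' with position
    ... | near _          = r
    ... | far s _ _ _ _ = s

    r-mod : r ≡ r' mod P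
    r-mod with position
    ... | near _          = mod-refl r
    ... | far _ p _ _ _ = p

    r'≤R : 0ℤ ≤ + R - r'
    r'≤R with position
    ... | near p          = p
    ... | far s _ _ _ p = 0≤-subst (eq (+ R) (+ E) s) (0≤-+ p (0≤+ E))
      where eq : ∀ R E s → R - E - s + E ≡ R - s
            eq = solve-∀

    shifted-bounded : ∀ c → Bounded K c → Bounded (K ℕ.+ K) (shifted c)
    shifted-bounded c bc = Bounded-minus c c* bc c*-bounded

    R+E-bound : ∀ e → 0ℤ ≤ + R - r → ∣ e ∣ ℕ.≤ E → ∣ r + e ∣ ℕ.≤ R ℕ.+ E
    R+E-bound e q be = ∣∣-≤ (r + e)
      (0≤-subst (eq₁ (+ E) (+ P) r e) (0≤-+ (0≤-+ -E≤r (0≤+-∣∣ e be)) (0≤+ (E ℕ.+ P))))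
      (0≤-subst (eq₂ (+ R) (+ E) r e) (0≤-+ q (0≤-∣∣ e be)))
      where
      eq₁ : ∀ E P r e → r + E + (E + e) + (E + P) ≡ E + E + P + E + (r + e)
      eq₁ = solve-∀
      eq₂ : ∀ R E r e → R - r + (E - e) ≡ R + E - (r + e)
      eq₂ = solve-∀

    to-shifted : ∀ c e → value c + e ≡ dot (shifted c) x + (r + e)
    to-shifted c e = trans (eq (+ (M ℕ.* a)) (dot c x) (dot c* x) e) (cong (_+ (r + e)) (sym (dot-minus c c* x)))
      where eq : ∀ u d d* e → u + d + e ≡ d - d* + (u + d* + e)
            eq = solve-∀

    swap : ∀ r d e → d + (r + e) ≡ r + d + e
    swap = solve-∀

    -- If `r` is near, the inequality concerns `shifted c` with the constant `r + e`, small enough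
    -- to be transferred. If it is far, `c` is itself a candidate, so minimality makes the form
    -- `shifted c` nonnegative at `x`, hence at `y`, and the new offset is at least `E`.
    forth : ∀ c e → Bounded K c → ∣ e ∣ ℕ.≤ E → 0ℤ ≤ value c + e → 0ℤ ≤ r' + dot (shifted c) y + e
    forth c e bc be p with position
    ... | near q = 0≤-subst (swap r (dot (shifted c) y) e)
          (signs ag (shifted c) (r + e) (shifted-bounded c bc) (R+E-bound e q be) (0≤-subst (to-shifted c e) p))
    ... | far s _ _ E≤s _ = 0≤-subst (eq s (+ E) e (dot (shifted c) y))
          (0≤-+ (0≤-+ E≤s (0≤+-∣∣ e be)) (signs ag (shifted c) 0ℤ (shifted-bounded c bc) ℕ.z≤n shifted≥0))
      where
      eq : ∀ s E e d → s - E + (E + e) + (d + 0ℤ) ≡ s + d + e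
      eq = solve-∀
      eq' : ∀ v e E → v + e + (E - e) ≡ v + E
      eq' = solve-∀
      eq″ : ∀ r d → d + (r + 0ℤ) - r ≡ d + 0ℤ
      eq″ = solve-∀
      good : Good c
      good = bc , 0≤-subst (eq' (value c) e (+ E)) (0≤-+ p (0≤-∣∣ e be))
      shifted≥0 : 0ℤ ≤ dot (shifted c) x + 0ℤ
      shifted≥0 = 0≤-subst
        (trans (cong (_- r) (trans (sym (+-identityʳ (value c))) (to-shifted c 0ℤ))) (eq″ r (dot (shifted c) x)))
        (i≤j⇒0≤j-i (best-least c good))

    -- In the far case the new offset is at most `R - E`, so the form `shifted c` is at least `- R`
    -- at `y`, hence at `x`. Since `r` exceeds `R`, this makes `c` a candidate, and minimality puts
    -- `value c` at or above `r`, which is larger than `E`.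
    back : ∀ c e → Bounded K c → ∣ e ∣ ℕ.≤ E → 0ℤ ≤ r' + dot (shifted c) y + e → 0ℤ ≤ value c + e
    back c e bc be p with position
    ... | near q = 0≤-subst (sym (to-shifted c e))
          (signs˘ ag (shifted c) (r + e) (shifted-bounded c bc) (R+E-bound e q be) (0≤-subst (sym (swap r (dot (shifted c) y) e)) p))
    ... | far s _ R<r _ s≤R-E =
          0≤-subst (eq₃ (value c) r (+ E) (+ P) e)
            (0≤-+ (0≤-+ (0≤-+ (i≤j⇒0≤j-i (best-least c good)) R<r) (0≤+-∣∣ e be)) (0≤+ (1 ℕ.+ (E ℕ.+ P))))
      where
      eq₁ : ∀ s d e R E → s + d + e + (R - E - s) + (E - e) ≡ d + R
      eq₁ = solve-∀
      eq₂ : ∀ r d R E → d + R + (r - R + -1ℤ) + (1ℤ + E) ≡ d + (r + E)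
      eq₂ = solve-∀
      eq₃ : ∀ v r E P e → v - r + (r - (E + E + P) + -1ℤ) + (E + e) + (1ℤ + (E + P)) ≡ v + e
      eq₃ = solve-∀
      shifted≥-R : 0ℤ ≤ dot (shifted c) x + + R
      shifted≥-R = signs˘ ag (shifted c) (+ R) (shifted-bounded c bc) (ℕ.m≤m+n R E)
        (0≤-subst (eq₁ s (dot (shifted c) y) e (+ R) (+ E)) (0≤-+ (0≤-+ p s≤R-E) (0≤-∣∣ e be)))
      good : Good c
      good = bc , 0≤-subst (trans (eq₂ r (dot (shifted c) x) (+ R) (+ E)) (sym (to-shifted c (+ E))))
                    (0≤-+ (0≤-+ shifted≥-R R<r) (0≤+ (1 ℕ.+ E)))

    -- Both `r` and `dot c* x` keep their residues mod `M * L` on the other side, so the new value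
    -- of `M * a` is congruent to the old one. Hence it is divisible by `M`, with a quotient
    -- congruent to `a` mod `L`.
    quotientᶻ : Σ ℤ λ t → r' - dot c* y ≡ + M * (+ a + t * + L)
    quotientᶻ with r-mod | dot-mod c* (mods ag)
    ... | t , p | s , q = t - s , trans (cong₂ _-_ p q)
            (trans (cong₂ (λ u v → u + dot c* x + t * v - (dot c* x + s * v)) (pos-* M a) (pos-* M L))
                   (eq (+ M) (+ a) (+ L) (dot c* x) t s))
      where eq : ∀ M a L d t s → M * a + d + t * (M * L) - (d + s * (M * L)) ≡ M * (a + (t - s) * L)
            eq = solve-∀

    bᶻ : ℤ
    bᶻ = + a + proj₁ quotientᶻ * + L

    M*bᶻ : ∀ c → r' + dot (shifted c) y ≡ + M * bᶻ + dot c y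
    M*bᶻ c = trans (cong (λ v → r' + v) (dot-minus c c* y))
              (trans (eq r' (dot c y) (dot c* y)) (cong (_+ dot c y) (proj₂ quotientᶻ)))
      where eq : ∀ r d d* → r + (d - d*) ≡ r - d* + d
            eq = solve-∀

    -- The zero form expresses that `M * a` is nonnegative, and `forth` carries this over.
    bᶻ≥0 : 0ℤ ≤ bᶻ
    bᶻ≥0 = 0≤-*-cancel M (0≤-subst
      (trans (+-identityʳ (r' + dot (shifted zeros) y)) (trans (M*bᶻ zeros) (trans (cong (λ v → + M * bᶻ + v) (dot-0 y)) (+-identityʳ (+ M * bᶻ)))))
      (forth zeros 0ℤ (λ _ → ℕ.z≤n) ℕ.z≤n
        (0≤-subst (cong (λ v → + (M ℕ.* a) + v + 0ℤ) (sym (dot-0 x))) (0≤+ (M ℕ.* a ℕ.+ 0 ℕ.+ 0)))))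
      where zeros : Vector ℤ n
            zeros _ = 0ℤ

    b : ℕ
    b = ∣ bᶻ ∣

    +b≡bᶻ : + b ≡ bᶻ
    +b≡bᶻ = 0≤i⇒+∣i∣≡i bᶻ≥0

    b-mod : (+ a) ≡ (+ b) mod L
    b-mod = proj₁ quotientᶻ , +b≡bᶻ

    M*b : ∀ c e → r' + dot (shifted c) y + e ≡ + (M ℕ.* b) + dot c y + e
    M*b c e = cong (_+ e) (trans (M*bᶻ c) (cong (_+ dot c y) (trans (cong (+ M *_) (sym +b≡bᶻ)) (sym (pos-* M b)))))

    -- Here `M * b` is the new offset, at most `R`, minus the bounded form `c*` at `y`.
    b-bound : b ℕ.≤ R ℕ.+ K ℕ.* sumᵛ y
    b-bound = ℕ.≤-trans (ℕ.m≤n*m b M) (drop‿+≤+ (0≤i-j⇒j≤i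
      (0≤-subst (trans (cong (λ v → + R - r' + (+ (K ℕ.* sumᵛ y) + v)) (sym (+-identityʳ (dot c* y))))
                  (trans (eq (+ R) r' (+ (K ℕ.* sumᵛ y)) (dot c* y))
                    (cong (λ v → + (R ℕ.+ K ℕ.* sumᵛ y) - v)
                       (trans (proj₂ quotientᶻ) (trans (cong (+ M *_) (sym +b≡bᶻ)) (sym (pos-* M b)))))))
                (0≤-+ r'≤R (0≤+-∣∣ (dot c* y) (dot-bound K c* y c*-bounded))))))
      where eq : ∀ R r k d → R - r + (k + (d + 0ℤ)) ≡ R + k - (r - d)
            eq = solve-∀

-- The back-and-forth property with linearly bounded answers.

module BackAndForth where

  open LinearForms
  open Agreement
  open import Data.Fin using (zero; suc)
  open import Data.Integer as ℤ hiding (suc; NonZero; _≤_)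
  open import Data.Integer.Properties hiding (≤-trans; ≤-reflexive)
  open import Data.Integer.Tactic.RingSolver using (solve-∀)
  open import Data.Nat as ℕ using (ℕ; zero; suc; _!; NonZero; _≤_)
  open import Data.Nat.Divisibility as ℕ using (divides)
  open import Data.Nat.Properties as ℕ using (≤-trans; ≤-reflexive)
  open import Data.Product using (Σ; _×_; _,_)
  open import Data.Vec.Functional using (Vector; _∷_)
  open import Function using (_∘_)
  open import Relation.Nullary using (yes; no; contradiction)
  open import Relation.Binary.PropositionalEquality

  suc-∣-! : ∀ k {K} → suc k ≤ K → Σ ℕ λ q → K ! ≡ q ℕ.* suc k × NonZero q × q ≤ K !
  suc-∣-! k {K} k<K with ℕ.∣-trans (ℕ.m∣m*n {suc k} (k !)) (ℕ.m≤n⇒m!∣n! k<K)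
  ... | divides q eq = q , eq
      , ℕ.m*n≢0⇒m≢0 q {{subst NonZero eq (K ℕ.!≢0)}}
      , ≤-trans (ℕ.m≤m*n q (suc k)) (≤-reflexive (sym eq))

  ScaledAgree : ∀ {n} → ℕ → ℕ → ℕ → ℕ → Vector ℕ n → ℕ → Vector ℕ n → Set
  ScaledAgree M K E a x b y = ∀ c e → Bounded K c → ∣ e ∣ ≤ E →
    0ℤ ℤ.≤ + (M ℕ.* a) + dot c x + e → 0ℤ ℤ.≤ + (M ℕ.* b) + dot c y + e

  -- The leading coefficient d of a form divides K !, so the form can be scaled to have
  -- leading coefficient ± K !; a negative leading coefficient is handled by complementing.
  unscale : ∀ {n} K E {a b} {x y : Vector ℕ n} → SignsAgree K E x y →
            ScaledAgree (K !) (K ! ℕ.* K) (K ! ℕ.* suc E) a x b y →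
            ScaledAgree (K !) (K ! ℕ.* K) (K ! ℕ.* suc E) b y a x →
            SignsAgree K E (a ∷ x) (b ∷ y)
  unscale {n} K E {a} {b} {x} {y} sgn H H' c e bc be p with c zero in c₀ | bc zero
  ... | + zero | _ = 0≤-subst (cong (_+ e) (sym (+-identityˡ (dot (c ∘ suc) y))))
        (sgn (c ∘ suc) e (bc ∘ suc) be (0≤-subst (cong (_+ e) (+-identityˡ (dot (c ∘ suc) x))) p))
  ... | + suc k | k<K with suc-∣-! k k<K
  ... | q , eq , q≢0 , q≤ = 0≤-*-cancel q {{q≢0}} (0≤-subst (sym (scaled b y))
        (H (λ i → + q * c (suc i)) (+ q * e) coeffs const (0≤-subst (scaled a x) (0≤-* q p))))
    where
    coeffs : Bounded (K ! ℕ.* K) (λ i → + q * c (suc i))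
    coeffs i = ≤-trans (Bounded-* (+ q) (c ∘ suc) (bc ∘ suc) i) (ℕ.*-monoˡ-≤ K q≤)
    const : ∣ + q * e ∣ ≤ K ! ℕ.* suc E
    const = ≤-trans (≤-reflexive (abs-* (+ q) e)) (ℕ.*-mono-≤ q≤ (ℕ.m≤n⇒m≤1+n be))
    ring-eq : ∀ q k a d e → q * (k * a + d + e) ≡ q * k * a + q * d + q * e
    ring-eq = solve-∀
    scaled : ∀ a x → + q * (+ suc k * + a + dot (c ∘ suc) x + e)
                   ≡ + (K ! ℕ.* a) + dot (λ i → + q * c (suc i)) x + + q * e
    scaled a x = trans (ring-eq (+ q) (+ suc k) (+ a) (dot (c ∘ suc) x) e)
      (cong₂ (λ u v → u + v + + q * e)
        (trans (cong (_* + a) (trans (sym (pos-* q (suc k))) (cong +_ (sym eq)))) (sym (pos-* (K !) a)))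
        (sym (dot-* (+ q) (c ∘ suc) x)))
  unscale {n} K E {a} {b} {x} {y} sgn H H' c e bc be p | -[1+ k ] | k<K with suc-∣-! k k<K
  ... | q , eq , q≢0 , q≤ with 0ℤ ≤? -[1+ k ] * + b + dot (c ∘ suc) y + e
  ... | yes p' = p'
  ... | no ¬p' = contradiction
        (0≤-*-cancel q {{q≢0}} (0≤-subst (sym (scaled a x))
          (H' (λ i → - + q * c (suc i)) (- + q * (e + 1ℤ)) coeffs const
            (0≤-subst (scaled b y) (0≤-* q (¬0≤⇒0≤-u-1 ¬p'))))))
        (0≤⇒¬0≤-u-1 p)
    where
    coeffs : Bounded (K ! ℕ.* K) (λ i → - + q * c (suc i))
    coeffs i = ≤-trans (Bounded-* (- + q) (c ∘ suc) (bc ∘ suc) i)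
                       (ℕ.*-monoˡ-≤ K (≤-trans (≤-reflexive (∣-i∣≡∣i∣ (+ q))) q≤))
    -- Complementing the inequality replaces `e` by `e + 1` up to sign; this is the origin of
    -- `suc E` in the bound.
    const : ∣ - + q * (e + 1ℤ) ∣ ≤ K ! ℕ.* suc E
    const = ≤-trans (≤-reflexive (abs-* (- + q) (e + 1ℤ)))
      (ℕ.*-mono-≤ (≤-trans (≤-reflexive (∣-i∣≡∣i∣ (+ q))) q≤)
                  (≤-trans (∣i+j∣≤∣i∣+∣j∣ e 1ℤ) (≤-trans (ℕ.+-monoˡ-≤ 1 be) (≤-reflexive (ℕ.+-comm E 1)))))
    ring-eq : ∀ q k a d e → q * (- ((- k) * a + d + e) + -1ℤ) ≡ q * k * a + (- q) * d + (- q) * (e + 1ℤ)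
    ring-eq = solve-∀
    scaled : ∀ a x → + q * (- (-[1+ k ] * + a + dot (c ∘ suc) x + e) + -1ℤ)
                   ≡ + (K ! ℕ.* a) + dot (λ i → - + q * c (suc i)) x + - + q * (e + 1ℤ)
    scaled a x = trans (ring-eq (+ q) (+ suc k) (+ a) (dot (c ∘ suc) x) e)
      (cong₂ (λ u v → u + v + - + q * (e + 1ℤ))
        (trans (cong (_* + a) (trans (sym (pos-* q (suc k))) (cong +_ (sym eq)))) (sym (pos-* (K !) a)))
        (sym (dot-* (- + q) (c ∘ suc) x)))

  -- One round of the game. The level needed beforehand and the constant `B` depend neither on the
  -- tuples nor on their length nor on the move.
  record Response (K E L : ℕ) : Set where
    field
      K' E' L' B : ℕ
      {{L'≢0}}   : NonZero L'
      respond    : ∀ {n} {x y : Vector ℕ n} → Agree K' E' L' x y → ∀ a →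
                   Σ ℕ λ b → b ≤ B ℕ.+ B ℕ.* sumᵛ y × Agree K E L (a ∷ x) (b ∷ y)

  -- All nonzero leading coefficients are scaled to `K !` in absolute value, which raises the other
  -- bounds to `K₁` and `E₁`; the coefficient bound then doubles because `Respond` works with
  -- differences of two forms.
  response : ∀ K E L → .{{_ : NonZero L}} → Response K E L
  response K E L = record
    { K' = K₁ ℕ.+ K₁ ; E' = R ℕ.+ E₁ ; L' = M ℕ.* L ; B = R ℕ.+ K₁ ; L'≢0 = ML≢0 ; respond = answer }
    where
    M K₁ E₁ R : ℕ
    M = K !
    K₁ = M ℕ.* K
    E₁ = M ℕ.* suc E
    R = E₁ ℕ.+ E₁ ℕ.+ M ℕ.* L
    instance
      M≢0 : NonZero M
      M≢0 = K ℕ.!≢0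
      ML≢0 : NonZero (M ℕ.* L)
      ML≢0 = ℕ.m*n≢0 M L
    K≤2K₁ : K ≤ K₁ ℕ.+ K₁
    K≤2K₁ = ≤-trans (ℕ.m≤n*m K M) (ℕ.m≤m+n K₁ K₁)
    E≤R+E₁ : E ≤ R ℕ.+ E₁
    E≤R+E₁ = ≤-trans (ℕ.n≤1+n E) (≤-trans (ℕ.m≤n*m (suc E) M) (ℕ.m≤n+m E₁ R))
    answer : ∀ {n} {x y : Vector ℕ n} → Agree (K₁ ℕ.+ K₁) (R ℕ.+ E₁) (M ℕ.* L) x y → ∀ a →
             Σ ℕ λ b → b ≤ (R ℕ.+ K₁) ℕ.+ (R ℕ.+ K₁) ℕ.* sumᵛ y × Agree K E L (a ∷ x) (b ∷ y)
    answer {n} {x} {y} ag a = b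
      , ≤-trans b-bound (ℕ.+-mono-≤ (ℕ.m≤m+n R K₁) (ℕ.*-monoˡ-≤ (sumᵛ y) (ℕ.m≤n+m K₁ R)))
      , agree (unscale K E {x = x} (signs ag') there here) (unscale K E {x = y} (signs˘ ag') here there)
              (λ { zero → b-mod ; (suc i) → mods ag' i })
      where
      open Respond K₁ E₁ M L x y ag a using (b; b-bound; b-mod; forth; back; M*b)
      ag' : Agree K E L x y
      ag' = Agree-mono M K≤2K₁ E≤R+E₁ ag
      there : ScaledAgree M K₁ E₁ a x b y
      there c e bc be p = 0≤-subst (M*b c e) (forth c e bc be p)
      here : ScaledAgree M K₁ E₁ b y a x
      here c e bc be p = back c e bc be (0≤-subst (sym (M*b c e)) p)

-- Presburger formulas: invariance, decidability, bounded witnesses, periodicity.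

module Presburger where

  open LinearForms
  open Agreement
  open BackAndForth
  open import Data.Fin using (Fin; zero; suc)
  open import Data.Integer as ℤ hiding (suc; NonZero; _≤_)
  open import Data.Integer.Properties hiding (≤-trans; ≤-reflexive; ≤-refl)
  open import Data.Integer.Tactic.RingSolver using (solve-∀)
  open import Data.Nat as ℕ using (ℕ; zero; suc; NonZero; _≤_; s≤s)
  open import Data.Nat.Properties as ℕ using (≤-trans; ≤-reflexive; ≤-refl; anyUpTo?)
  open import Data.Product using (Σ; _×_; _,_)
  open import Data.Vec.Functional using (Vector; _∷_)
  open import Function using (_∘_; _⇔_; mk⇔)
  open import Relation.Nullary using (¬_; Dec; yes; no; contradiction; ¬?; _×-dec_)
  open import Relation.Nullary.Decidable using (decidable-stable)
  open import Relation.Binary.PropositionalEquality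

  unit : ∀ {n} → Fin n → Vector ℤ n
  unit zero    zero    = 1ℤ
  unit zero    (suc j) = 0ℤ
  unit (suc i) zero    = 0ℤ
  unit (suc i) (suc j) = unit i j

  dot-unit : ∀ {n} (i : Fin n) x → dot (unit i) x ≡ + x i
  dot-unit zero    x = trans (cong₂ _+_ (*-identityˡ (+ x zero)) (dot-0 (x ∘ suc))) (+-identityʳ _)
  dot-unit (suc i) x = trans (+-identityˡ _) (dot-unit i (x ∘ suc))

  unit-bounded : ∀ {n} (i : Fin n) → Bounded 1 (unit i)
  unit-bounded zero    zero    = ≤-refl
  unit-bounded zero    (suc j) = ℕ.z≤n
  unit-bounded (suc i) zero    = ℕ.z≤n
  unit-bounded (suc i) (suc j) = unit-bounded i j

  coeffs : ∀ {n} → Term n → Vector ℤ n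
  coeffs (var i)  = unit i
  coeffs (s ⊕ₜ t) i = coeffs s i + coeffs t i

  size : ∀ {n} → Term n → ℕ
  size (var i)  = 1
  size (s ⊕ₜ t) = size s ℕ.+ size t

  coeffs-bounded : ∀ {n} (t : Term n) → Bounded (size t) (coeffs t)
  coeffs-bounded (var i)    = unit-bounded i
  coeffs-bounded (s ⊕ₜ t) i =
    ≤-trans (∣i+j∣≤∣i∣+∣j∣ (coeffs s i) (coeffs t i)) (ℕ.+-mono-≤ (coeffs-bounded s i) (coeffs-bounded t i))

  dot-coeffs : ∀ {n} (t : Term n) x → dot (coeffs t) x ≡ + ⟦_⟧ₜ ℕ-str t x
  dot-coeffs (var i)  x = dot-unit i x
  dot-coeffs (s ⊕ₜ t) x = trans (dot-+ (coeffs s) (coeffs t) x) (cong₂ _+_ (dot-coeffs s x) (dot-coeffs t x))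

  difference : ∀ {n} → Term n → Term n → Vector ℤ n
  difference s t i = coeffs s i - coeffs t i

  dot-difference : ∀ {n} (s t : Term n) x →
                   dot (difference s t) x + 0ℤ ≡ + ⟦_⟧ₜ ℕ-str s x - + ⟦_⟧ₜ ℕ-str t x
  dot-difference s t x = trans (+-identityʳ _)
    (trans (dot-minus (coeffs s) (coeffs t) x) (cong₂ _-_ (dot-coeffs s x) (dot-coeffs t x)))

  term-≥ : ∀ {n K E L} (s t : Term n) {x y : Vector ℕ n} → size s ℕ.+ size t ≤ K → Agree K E L x y →
           ⟦_⟧ₜ ℕ-str t x ≤ ⟦_⟧ₜ ℕ-str s x → ⟦_⟧ₜ ℕ-str t y ≤ ⟦_⟧ₜ ℕ-str s y
  term-≥ s t {x} {y} sz ag p = drop‿+≤+ (0≤i-j⇒j≤i (0≤-subst (dot-difference s t y)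
    (signs ag (difference s t) 0ℤ
      (λ i → ≤-trans (Bounded-minus (coeffs s) (coeffs t) (coeffs-bounded s) (coeffs-bounded t) i) sz)
      ℕ.z≤n (0≤-subst (sym (dot-difference s t x)) (i≤j⇒0≤j-i (+≤+ p))))))

  -- A semantic substitute for quantifier elimination: some finite level of agreement determines the
  -- truth value.
  record Regular {n} (φ : Formula n) : Set where
    field
      K E L     : ℕ
      {{L≢0}}   : NonZero L
      invariant : ∀ {x y} → Agree K E L x y → ℕ-str ⊨ φ [ x ] → ℕ-str ⊨ φ [ y ]

  open Response

  -- An equation is a pair of inequalities between terms, hence a condition on signs of bounded
  -- forms. A conjunction takes maxima of the bounds and the product of the moduli; a quantifier
  -- costs one `response`.
  regular : ∀ {n} (φ : Formula n) → Regular φ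
  regular (s ≐ t) = record
    { K = size s ℕ.+ size t ; E = 0 ; L = 1
    ; invariant = λ ag eq → ℕ.≤-antisym
        (term-≥ t s (≤-reflexive (ℕ.+-comm (size t) (size s))) ag (≤-reflexive eq))
        (term-≥ s t ≤-refl ag (≤-reflexive (sym eq))) }
  regular (¬ᶠ φ) = record
    { Regular (regular φ)
    ; invariant = λ ag ¬p p → ¬p (Regular.invariant (regular φ) (Agree-sym ag) p) }
  regular (φ ∧ᶠ ψ) = record
    { K = Φ.K ℕ.⊔ Ψ.K ; E = Φ.E ℕ.⊔ Ψ.E ; L = Φ.L ℕ.* Ψ.L ; L≢0 = ℕ.m*n≢0 Φ.L Ψ.L {{Φ.L≢0}} {{Ψ.L≢0}}
    ; invariant = λ {x} {y} ag (p , q) →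
          Φ.invariant (Agree-mono Ψ.L (ℕ.m≤m⊔n Φ.K Ψ.K) (ℕ.m≤m⊔n Φ.E Ψ.E)
                        (subst (λ L → Agree (Φ.K ℕ.⊔ Ψ.K) (Φ.E ℕ.⊔ Ψ.E) L x y) (ℕ.*-comm Φ.L Ψ.L) ag)) p
        , Ψ.invariant (Agree-mono Φ.L (ℕ.m≤n⊔m Φ.K Ψ.K) (ℕ.m≤n⊔m Φ.E Ψ.E) ag) q }
    where module Φ = Regular (regular φ)
          module Ψ = Regular (regular ψ)
  regular (∀ᶠ φ) = record
    { K = K' R ; E = E' R ; L = L' R ; L≢0 = L'≢0 R
    ; invariant = λ ag f b →
        let a , _ , ag' = respond R (Agree-sym ag) b
        in Φ.invariant (Agree-sym ag') (f a) }
    where module Φ = Regular (regular φ)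
          R = response Φ.K Φ.E Φ.L {{Φ.L≢0}}

  search-bound : ∀ {n} → Formula (suc n) → ℕ
  search-bound φ = B (response Φ.K Φ.E Φ.L {{Φ.L≢0}})
    where module Φ = Regular (regular φ)

  -- The game is played on `x` against itself: the answer to the move `a` is a small witness.
  bounded-witness : ∀ {n} (φ : Formula (suc n)) x a → ℕ-str ⊨ φ [ a ∷ x ] →
                    Σ ℕ λ b → b ≤ search-bound φ ℕ.+ search-bound φ ℕ.* sumᵛ x × ℕ-str ⊨ φ [ b ∷ x ]
  bounded-witness φ x a p =
    let b , b≤ , ag = respond (response Φ.K Φ.E Φ.L {{Φ.L≢0}}) (Agree-refl x) a
    in b , b≤ , Φ.invariant ag p
    where module Φ = Regular (regular φ)

  -- A counterexample to a universal formula can be taken below the bound of `bounded-witness`, so a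
  -- finite search settles each quantifier.
  sat? : ∀ {n} (φ : Formula n) x → Dec (ℕ-str ⊨ φ [ x ])
  sat-∃? : ∀ {n} (φ : Formula (suc n)) x → Dec (Σ ℕ λ a → ¬ (ℕ-str ⊨ φ [ a ∷ x ]))

  sat? (s ≐ t)  x = ⟦_⟧ₜ ℕ-str s x ℕ.≟ ⟦_⟧ₜ ℕ-str t x
  sat? (¬ᶠ φ)   x = ¬? (sat? φ x)
  sat? (φ ∧ᶠ ψ) x = sat? φ x ×-dec sat? ψ x
  sat? (∀ᶠ φ)   x with sat-∃? φ x
  ... | yes (a , ¬p) = no λ f → ¬p (f a)
  ... | no ¬∃        = yes λ a → decidable-stable (sat? φ (a ∷ x)) (λ ¬p → ¬∃ (a , ¬p))

  sat-∃? φ x with anyUpTo? (λ a → ¬? (sat? φ (a ∷ x))) (suc (search-bound (¬ᶠ φ) ℕ.+ search-bound (¬ᶠ φ) ℕ.* sumᵛ x))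
  ... | yes (a , _ , ¬p) = yes (a , ¬p)
  ... | no ¬∃ = no λ (a , ¬p) → let b , b≤ , q = bounded-witness (¬ᶠ φ) x a ¬p in ¬∃ (b , s≤s b≤ , q)

  ∃ᶠ⇒Σ : ∀ {n} (φ : Formula (suc n)) x → ℕ-str ⊨ ∃ᶠ φ [ x ] → Σ ℕ λ a → ℕ-str ⊨ φ [ a ∷ x ]
  ∃ᶠ⇒Σ φ x p with sat-∃? (¬ᶠ φ) x
  ... | yes (a , ¬¬q) = a , decidable-stable (sat? φ (a ∷ x)) ¬¬q
  ... | no ¬∃ = contradiction (λ a q → ¬∃ (a , λ ¬q → ¬q q)) p

  -- Pointwise equal assignments agree at every level, in particular at the one provided by
  -- `regular φ`.
  sat-cong : ∀ {n} (φ : Formula n) {x y : Vector ℕ n} → x ≗ y → ℕ-str ⊨ φ [ x ] → ℕ-str ⊨ φ [ y ]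
  sat-cong φ {x} {y} x≗y = Regular.invariant (regular φ) (agree
    (λ c e _ _ → 0≤-subst (cong (_+ e) (dot-congʳ c x≗y)))
    (λ c e _ _ → 0≤-subst (cong (_+ e) (sym (dot-congʳ c x≗y))))
    (λ i → 0ℤ , trans (cong +_ (sym (x≗y i))) (sym (+-identityʳ _))))
    where
    dot-congʳ : ∀ {n} (c : Vector ℤ n) {x y : Vector ℕ n} → x ≗ y → dot c x ≡ dot c y
    dot-congʳ {zero}  c eq = refl
    dot-congʳ {suc n} c eq = cong₂ _+_ (cong (λ v → c zero * + v) (eq zero)) (dot-congʳ (c ∘ suc) (eq ∘ suc))

  -- Once the first entry outweighs the other entries and the constant, a nonzero leading
  -- coefficient alone decides the sign.
  large-agree : ∀ {n} K E (x : Vector ℕ n) {N N'} →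
                K ℕ.* sumᵛ x ℕ.+ E ℕ.< N → K ℕ.* sumᵛ x ℕ.+ E ℕ.< N' → SignsAgree K E (N ∷ x) (N' ∷ x)
  large-agree K E x {N} {N'} N> N'> c e bc be p with c zero
  ... | + zero = p
  ... | + suc k = 0≤-subst (eq (+ k) (+ N') (dot (c ∘ suc) x) e (+ (K ℕ.* sumᵛ x)) (+ E))
          (0≤-+ (0≤-+ (0≤-+ (0≤-+ (0≤-* k (0≤+ N')) (i≤j⇒0≤j-i (+≤+ N'>)))
             (0≤+-∣∣ (dot (c ∘ suc) x) (dot-bound K (c ∘ suc) x (bc ∘ suc)))) (0≤+-∣∣ e be)) (0≤+ 1))
    where eq : ∀ k N d e S E → k * N + (N - (1ℤ + (S + E))) + (S + d) + (E + e) + 1ℤ ≡ (1ℤ + k) * N + d + e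
          eq = solve-∀
  ... | -[1+ k ] = contradiction
          (0≤-subst (eq (+ k) (+ N) (dot (c ∘ suc) x) e (+ (K ℕ.* sumᵛ x)) (+ E))
            (0≤-+ (0≤-+ (0≤-+ (0≤-+ p (0≤-* k (0≤+ N))) (i≤j⇒0≤j-i (+≤+ N>)))
              (0≤-∣∣ (dot (c ∘ suc) x) (dot-bound K (c ∘ suc) x (bc ∘ suc)))) (0≤-∣∣ e be)))
          λ ()
    where eq : ∀ k N d e S E → (- (1ℤ + k)) * N + d + e + k * N + (N - (1ℤ + (S + E))) + (S - d) + (E - e) ≡ -1ℤ
          eq = solve-∀

  record Periodic (P : ℕ → Set) : Set where
    field
      threshold period : ℕ
      {{period≢0}}     : NonZero period
      shift            : ∀ N → threshold ≤ N → P N ⇔ P (N ℕ.+ period)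

  periodic : ∀ {n} (φ : Formula (suc n)) x → Periodic (λ N → ℕ-str ⊨ φ [ N ∷ x ])
  periodic φ x = record
    { threshold = suc (K ℕ.* sumᵛ x ℕ.+ E) ; period = L ; period≢0 = L≢0
    ; shift = λ N N> → let ag = shifted-agree N N> in mk⇔ (invariant ag) (invariant (Agree-sym ag)) }
    where
    open Regular (regular φ)
    shifted-agree : ∀ N → K ℕ.* sumᵛ x ℕ.+ E ℕ.< N → Agree K E L (N ∷ x) ((N ℕ.+ L) ∷ x)
    shifted-agree N N> = agree
      (large-agree K E x N> (≤-trans N> (ℕ.m≤m+n N L)))
      (large-agree K E x (≤-trans N> (ℕ.m≤m+n N L)) N>)
      λ { zero → 1ℤ , cong (λ v → + N + v) (sym (*-identityˡ (+ L))) ; (suc i) → mod-refl _ }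

-- Least elements, gaps in periodic sets, and a growth estimate.

module Naturals where

  open Presburger using (Periodic)
  open import Data.Nat as ℕ using (zero; suc; _+_; _*_; _^_; _⊔_; NonZero; s≤s; z≤n)
  import Data.Nat.Properties as ℕ
  open import Data.Nat.Tactic.RingSolver using (solve-∀)
  open import Data.Product using (Σ; _×_; _,_)
  open import Data.Sum using (_⊎_; inj₁; inj₂)
  open import Function using (Equivalence)
  open import Relation.Nullary using (¬_; Dec; yes; no)
  open import Relation.Binary.PropositionalEquality
  open Equivalence using (from)

  first : {P : ℕ → Set} → (∀ n → Dec (P n)) → ∀ n → P n → Σ ℕ λ k → P k × (∀ j → j ℕ.< k → ¬ P j)
  first {P} P? n p with search n
    where
    search : ∀ n → (Σ ℕ λ k → P k × (∀ j → j ℕ.< k → ¬ P j)) ⊎ (∀ j → j ℕ.< n → ¬ P j)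
    search zero = inj₂ λ j ()
    search (suc n) with search n
    ... | inj₁ found = inj₁ found
    ... | inj₂ none with P? n
    ...   | yes p = inj₁ (n , p , none)
    ...   | no ¬p = inj₂ λ j j<1+n → case j (ℕ.m<1+n⇒m<n∨m≡n j<1+n)
      where case : ∀ j → j ℕ.< n ⊎ j ≡ n → ¬ P j
            case j (inj₁ j<n)  = none j j<n
            case j (inj₂ refl) = ¬p
  ... | inj₁ found = found
  ... | inj₂ none  = n , p , none

  -- Cut a periodic unbounded set down by its period until it lands just after N.
  bounded-gaps : ∀ {P} → Periodic P → ∀ T → (∀ N → T ℕ.≤ N → Σ ℕ λ N' → N ℕ.< N' × P N') →
                 Σ ℕ λ p → Σ ℕ λ T' → T ℕ.≤ T' × (∀ N → T' ℕ.≤ N → Σ ℕ λ N' → N ℕ.< N' × N' ℕ.≤ N + p × P N')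
  bounded-gaps {P} periodic T unbounded = period , T' , ℕ.m≤m⊔n T threshold , λ N T'≤N →
      let N' , N<N' , p = unbounded N (ℕ.≤-trans (ℕ.m≤m⊔n T threshold) T'≤N)
      in reduce N (ℕ.≤-trans (ℕ.m≤n⊔m T threshold) T'≤N) N' N' ℕ.≤-refl N<N' p
    where
    open Periodic periodic
    T' = T ⊔ threshold
    reduce : ∀ N → threshold ℕ.≤ N → ∀ fuel N' → N' ℕ.≤ fuel → N ℕ.< N' → P N' →
             Σ ℕ λ N″ → N ℕ.< N″ × N″ ℕ.≤ N + period × P N″
    reduce N t≤N fuel N' N'≤fuel N<N' p with N' ℕ.≤? N + period
    ... | yes N'≤ = N' , N<N' , N'≤ , p
    reduce N t≤N zero       zero     N'≤fuel () p | no _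
    reduce N t≤N (suc fuel) N' N'≤fuel N<N' p | no N'≰ =
      reduce N t≤N fuel (N' ℕ.∸ period)
        (ℕ.≤-pred (ℕ.≤-trans (ℕ.∸-monoʳ-< (ℕ.>-nonZero⁻¹ period) period≤N') N'≤fuel))
        N<N'-p
        (from (shift (N' ℕ.∸ period) (ℕ.≤-trans t≤N (ℕ.<⇒≤ N<N'-p)))
              (subst P (sym (ℕ.m∸n+n≡m period≤N')) p))
      where
      N+p<N' : N + period ℕ.< N'
      N+p<N' = ℕ.≰⇒> N'≰
      period≤N' : period ℕ.≤ N'
      period≤N' = ℕ.≤-trans (ℕ.m≤n+m period N) (ℕ.<⇒≤ N+p<N')
      N<N'-p : N ℕ.< N' ℕ.∸ period
      N<N'-p = ℕ.+-cancelʳ-< period N (N' ℕ.∸ period) (subst (N + period ℕ.<_) (sym (ℕ.m∸n+n≡m period≤N')) N+p<N')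

  n<2^n : ∀ n → n ℕ.< 2 ^ n
  n<2^n zero    = s≤s z≤n
  n<2^n (suc n) = ℕ.≤-trans (s≤s (n<2^n n)) (ℕ.≤-trans (ℕ.+-monoˡ-≤ (2 ^ n) (ℕ.m^n>0 2 n))
                    (ℕ.≤-reflexive (cong (2 ^ n +_) (sym (ℕ.+-identityʳ (2 ^ n))))))

  ^-distribʳ-* : ∀ k a b → (a * b) ^ k ≡ a ^ k * b ^ k
  ^-distribʳ-* zero    a b = refl
  ^-distribʳ-* (suc k) a b = trans (cong (a * b *_) (^-distribʳ-* k a b)) (interchange a b (a ^ k) (b ^ k))
    where interchange : ∀ a b c d → a * b * (c * d) ≡ a * c * (b * d)
          interchange = solve-∀

  -- Both sides carry the factor (c ^ m) ^ (2 q); what remains is q * 2 ≤ 2 ^ (2 q).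
  power-estimate : ∀ m c → .{{_ : NonZero c}} → ∀ B N R q → q ≡ suc (B * N) ^ m → R ℕ.≤ B * (c ^ (2 * q) * N) →
                   suc R ^ m * 2 ℕ.≤ (2 * c ^ m) ^ (2 * q)
  power-estimate m c B N R q q≡ R≤ = begin
    suc R ^ m * 2                       ≤⟨ ℕ.*-monoˡ-≤ 2 (ℕ.^-monoˡ-≤ m R<) ⟩
    (suc (B * N) * c ^ i) ^ m * 2       ≡⟨ cong (_* 2) (^-distribʳ-* m (suc (B * N)) (c ^ i)) ⟩
    suc (B * N) ^ m * (c ^ i) ^ m * 2   ≡⟨ cong₂ (λ u v → u * v * 2) (sym q≡) swap ⟩
    q * (c ^ m) ^ i * 2                 ≡⟨ rearrange q ((c ^ m) ^ i) ⟩
    2 * q * (c ^ m) ^ i                 ≤⟨ ℕ.*-monoˡ-≤ ((c ^ m) ^ i) (ℕ.<⇒≤ (n<2^n i)) ⟩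
    2 ^ i * (c ^ m) ^ i                 ≡⟨ ^-distribʳ-* i 2 (c ^ m) ⟨
    (2 * c ^ m) ^ i                     ∎
    where
    open ℕ.≤-Reasoning
    i = 2 * q
    rearrange : ∀ q e → q * e * 2 ≡ 2 * q * e
    rearrange = solve-∀
    distrib : ∀ B e N → e + B * (e * N) ≡ (1 + B * N) * e
    distrib = solve-∀
    R< : suc R ℕ.≤ suc (B * N) * c ^ i
    R< = ℕ.≤-trans (ℕ.+-mono-≤ (ℕ.m^n>0 c i) R≤) (ℕ.≤-reflexive (distrib B (c ^ i) N))
    swap : (c ^ i) ^ m ≡ (c ^ m) ^ i
    swap = trans (ℕ.^-*-assoc c i m) (trans (cong (c ^_) (ℕ.*-comm i m)) (sym (ℕ.^-*-assoc c m i)))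

-- Renaming of variables and derived formulas.

module Renaming where

  open Presburger using (sat-cong; sat?; ∃ᶠ⇒Σ)
  open import Data.Fin using (Fin; zero; suc; splitAt)
  open import Data.Nat as ℕ using (ℕ; zero; suc; _≤_)
  open import Data.Nat.Properties as ℕ using (m+[n∸m]≡n; m≤m+n)
  open import Data.Product using (Σ; _,_; proj₂)
  open import Data.Sum using (inj₁; inj₂)
  open import Data.Vec.Functional using (Vector; _∷_; _++_)
  open import Function using (_∘_; _⇔_; mk⇔; Equivalence)
  open import Relation.Binary.PropositionalEquality
  open Equivalence using (to; from)

  ∘-++ : ∀ {X Y : Set} {a b} (ρ : X → Y) (f : Vector X a) (g : Vector X b) →
         (ρ ∘ f) ++ (ρ ∘ g) ≗ ρ ∘ (f ++ g)
  ∘-++ {a = a} ρ f g i with splitAt a i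
  ... | inj₁ _ = refl
  ... | inj₂ _ = refl

  ∷-++ : ∀ {X : Set} {a b} x (f : Vector X a) (g : Vector X b) → x ∷ (f ++ g) ≗ (x ∷ f) ++ g
  ∷-++         x f g zero = refl
  ∷-++ {a = a} x f g (suc i) with splitAt a i
  ... | inj₁ _ = refl
  ... | inj₂ _ = refl

  lift : ∀ {a b} → (Fin a → Fin b) → Fin (suc a) → Fin (suc b)
  lift f = zero ∷ (suc ∘ f)

  renameₜ : ∀ {a b} → (Fin a → Fin b) → Term a → Term b
  renameₜ f (var i)  = var (f i)
  renameₜ f (s ⊕ₜ t) = renameₜ f s ⊕ₜ renameₜ f t

  rename : ∀ {a b} → (Fin a → Fin b) → Formula a → Formula b
  rename f (s ≐ t)  = renameₜ f s ≐ renameₜ f t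
  rename f (¬ᶠ φ)   = ¬ᶠ rename f φ
  rename f (φ ∧ᶠ ψ) = rename f φ ∧ᶠ rename f ψ
  rename f (∀ᶠ φ)   = ∀ᶠ (rename (lift f) φ)

  ⟦renameₜ⟧ : ∀ {a b} (f : Fin a → Fin b) t (ρ : Vector ℕ b) →
              ⟦_⟧ₜ ℕ-str (renameₜ f t) ρ ≡ ⟦_⟧ₜ ℕ-str t (ρ ∘ f)
  ⟦renameₜ⟧ f (var i)  ρ = refl
  ⟦renameₜ⟧ f (s ⊕ₜ t) ρ = cong₂ ℕ._+_ (⟦renameₜ⟧ f s ρ) (⟦renameₜ⟧ f t ρ)

  sat-rename : ∀ {a b} (f : Fin a → Fin b) φ (ρ : Vector ℕ b) →
               ℕ-str ⊨ rename f φ [ ρ ] ⇔ ℕ-str ⊨ φ [ ρ ∘ f ]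
  sat-rename f (s ≐ t)  ρ rewrite ⟦renameₜ⟧ f s ρ | ⟦renameₜ⟧ f t ρ = mk⇔ (λ p → p) (λ p → p)
  sat-rename f (¬ᶠ φ)   ρ = let e = sat-rename f φ ρ in mk⇔ (_∘ from e) (_∘ to e)
  sat-rename f (φ ∧ᶠ ψ) ρ = let e = sat-rename f φ ρ ; e' = sat-rename f ψ ρ in
    mk⇔ (λ (p , q) → to e p , to e' q) (λ (p , q) → from e p , from e' q)
  sat-rename f (∀ᶠ φ)   ρ = mk⇔
    (λ p a → sat-cong φ (λ { zero → refl ; (suc i) → refl }) (to (sat-rename (lift f) φ (a ∷ ρ)) (p a)))
    (λ p a → from (sat-rename (lift f) φ (a ∷ ρ)) (sat-cong φ (λ { zero → refl ; (suc i) → refl }) (p a)))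

  ∃ⁿ : ∀ m {n} → Formula (m ℕ.+ n) → Formula n
  ∃ⁿ zero    φ = φ
  ∃ⁿ (suc m) φ = ∃ⁿ m (∃ᶠ φ)

  sat-∃ⁿ : ∀ m {n} (φ : Formula (m ℕ.+ n)) ρ →
           ℕ-str ⊨ ∃ⁿ m φ [ ρ ] ⇔ Σ (Vector ℕ m) λ b → ℕ-str ⊨ φ [ b ++ ρ ]
  sat-∃ⁿ zero    φ ρ = mk⇔ (λ p → (λ ()) , p) proj₂
  sat-∃ⁿ (suc m) φ ρ = mk⇔
    (λ p → let b , q = to (sat-∃ⁿ m (∃ᶠ φ) ρ) p ; a , r = ∃ᶠ⇒Σ φ (b ++ ρ) q
           in a ∷ b , sat-cong φ (∷-++ a b ρ) r)
    (λ (b , p) → from (sat-∃ⁿ m (∃ᶠ φ) ρ)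
      (b ∘ suc , λ ∀¬ → ∀¬ (b zero) (sat-cong φ
        (λ i → sym (trans (∷-++ (b zero) (b ∘ suc) ρ i) (η b ρ i))) p)))
    where
    η : ∀ {a c} (b : Vector ℕ (suc a)) (ρ : Vector ℕ c) → (b zero ∷ (b ∘ suc)) ++ ρ ≗ b ++ ρ
    η b ρ zero = refl
    η {a} b ρ (suc i) with splitAt a i
    ... | inj₁ _ = refl
    ... | inj₂ _ = refl

  _≤ᶠ_ : ∀ {n} → Fin n → Fin n → Formula n
  i ≤ᶠ j = ∃ᶠ ((var (suc i) ⊕ₜ var zero) ≐ var (suc j))

  sat-≤ᶠ : ∀ {n} (i j : Fin n) ρ → ℕ-str ⊨ i ≤ᶠ j [ ρ ] ⇔ ρ i ≤ ρ j
  sat-≤ᶠ i j ρ = mk⇔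
    (λ p → let a , eq = ∃ᶠ⇒Σ ((var (suc i) ⊕ₜ var zero) ≐ var (suc j)) ρ p
           in subst (ρ i ≤_) eq (m≤m+n (ρ i) a))
    (λ le ∀¬ → ∀¬ (ρ j ℕ.∸ ρ i) (m+[n∸m]≡n le))

  ⋀ : ∀ m {n} → (Fin m → Formula n) → Formula n
  -- Truth is written as a quantified identity because `n` may be 0 and the signature has no closed
  -- terms.
  ⋀ zero    φ = ∀ᶠ (var zero ≐ var zero)
  ⋀ (suc m) φ = φ zero ∧ᶠ ⋀ m (φ ∘ suc)

  sat-⋀ : ∀ m {n} (φ : Fin m → Formula n) ρ → ℕ-str ⊨ ⋀ m φ [ ρ ] ⇔ (∀ i → ℕ-str ⊨ φ i [ ρ ])
  sat-⋀ zero    φ ρ = mk⇔ (λ _ ()) (λ _ _ → refl)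
  sat-⋀ (suc m) φ ρ = let e = sat-⋀ m (φ ∘ suc) ρ in mk⇔
    (λ { (p , q) zero → p ; (p , q) (suc i) → to e q i })
    (λ p → p zero , from e (p ∘ suc))

-- A two-sorted language over the numbers and the interpreted structure, reduced to Presburger
-- formulas.

module TwoSorted {m : ℕ} (𝔄 : Structure) (ι : Translation m) (I : IsInterpretation ι 𝔄) where

  open Enumeration
  open LinearForms using (sumᵛ)
  open Presburger
  open Renaming
  open Structure 𝔄
  open Translation ι
  open IsInterpretation I
  open import Data.Fin using (Fin; zero; suc; _↑ˡ_; _↑ʳ_; combine; remQuot)
  open import Data.Fin.Properties using (remQuot-combine)
  open import Data.List using (List; []; _∷_; length; upTo)
  open import Data.List.Membership.Propositional using (_∈_)
  open import Data.List.Membership.Propositional.Properties using (∈-upTo⁺)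
  open import Data.List.Properties using (length-upTo)
  open import Data.List.Relation.Unary.Any using (here; there)
  open import Data.Nat as ℕ using (zero; suc; _+_; _*_; _^_; _≤_; _<_; NonZero; s≤s)
  open import Data.Nat.Properties hiding (_≟_)
  open import Data.Nat.Tactic.RingSolver using (solve-∀)
  open import Data.Product using (Σ; _×_; _,_; proj₁; proj₂)
  open import Data.Vec.Functional using (Vector; _++_) renaming (_∷_ to _∷ᵛ_; [] to []ᵛ)
  open import Data.Vec.Functional.Properties using (++-cong; lookup-++ˡ; lookup-++ʳ)
  open import Function using (_∘_; _⇔_; mk⇔; Equivalence)
  open import Relation.Nullary using (¬_; Dec; yes; no; contradiction)
  open import Relation.Nullary.Decidable using (decidable-stable; map′)
  open import Relation.Binary.PropositionalEquality
  open Equivalence using (to; from)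

  Rep : Vector ℕ m → Carrier → Set
  Rep b x = Σ (D b) λ d → h b d ≡ x

  -- The map `h` need not respect pointwise equality by itself, but `PredEq` does by `sat-cong`, and
  -- the kernel of `h` is `_∼_`.
  Rep-cong : ∀ {b b' x} → b ≗ b' → Rep b x → Rep b' x
  Rep-cong {b} {b'} eq (d , refl) = d'
    , sym (from (h-kernel b b' d d') (sat-cong PredEq (++-cong b b (λ _ → refl) eq) (∼-refl b d)))
    where d' = sat-cong Dom eq d

  Rep-∼ : ∀ {b b' x y} → Rep b x → Rep b' y → x ≡ y ⇔ b ∼ b'
  Rep-∼ (d , refl) (d' , refl) = h-kernel _ _ d d'

  Rep-⊕ : ∀ {b₀ b₁ b₂ x y z} → Rep b₀ x → Rep b₁ y → Rep b₂ z →
          x ≡ y ⊕ z ⇔ ℕ-str ⊨ FunPlus [ b₀ ++ (b₁ ++ b₂) ]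
  Rep-⊕ (d₀ , refl) (d₁ , refl) (d₂ , refl) = h-plus _ _ _ d₀ d₁ d₂

  representative : ∀ x → Σ (Vector ℕ m) λ b → Rep b x
  representative = h-surj

  abstract

    _≟_ : (x y : Carrier) → Dec (x ≡ y)
    x ≟ y = let b , p = representative x ; b' , p' = representative y in
      map′ (from (Rep-∼ p p')) (to (Rep-∼ p p')) (sat? PredEq (b ++ b'))

  Norm≤ : Carrier → ℕ → Set
  Norm≤ x N = Σ (Vector ℕ m) λ b → (∀ i → b i ≤ N) × Rep b x

  -- Formulas with k variables ranging over ℕ and l variables ranging over the interpreted structure.
  data Formula₂ (k l : ℕ) : Set where
    _≐₂_⊕₂_       : Fin l → Fin l → Fin l → Formula₂ k l
    ∥_∥≤_       : Fin l → Fin k → Formula₂ k l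
    _<₂_        : Fin k → Fin k → Formula₂ k l
    ¬₂_         : Formula₂ k l → Formula₂ k l
    _∧₂_ _⇒₂_   : Formula₂ k l → Formula₂ k l → Formula₂ k l
    ∀ᴺ_ ∃ᴺ_     : Formula₂ (suc k) l → Formula₂ k l
    ∀ᴬ_ ∃ᴬ_     : Formula₂ k (suc l) → Formula₂ k l

  infix  8 _≐₂_⊕₂_ ∥_∥≤_ _<₂_
  infix  7 ¬₂_
  infixr 6 _∧₂_
  infixr 5 _⇒₂_
  infix  4 ∀ᴺ_ ∃ᴺ_ ∀ᴬ_ ∃ᴬ_

  ⟦_⟧ : ∀ {k l} → Formula₂ k l → Vector ℕ k → Vector Carrier l → Set
  ⟦ x ≐₂ y ⊕₂ z ⟧ ν σ = σ x ≡ σ y ⊕ σ z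
  ⟦ ∥ x ∥≤ N ⟧ ν σ  = Norm≤ (σ x) (ν N)
  ⟦ M <₂ N ⟧ ν σ    = ν M < ν N
  ⟦ ¬₂ φ ⟧ ν σ      = ¬ ⟦ φ ⟧ ν σ
  ⟦ φ ∧₂ ψ ⟧ ν σ    = ⟦ φ ⟧ ν σ × ⟦ ψ ⟧ ν σ
  ⟦ φ ⇒₂ ψ ⟧ ν σ    = ⟦ φ ⟧ ν σ → ⟦ ψ ⟧ ν σ
  ⟦ ∀ᴺ φ ⟧ ν σ      = ∀ N → ⟦ φ ⟧ (N ∷ᵛ ν) σ
  ⟦ ∃ᴺ φ ⟧ ν σ      = Σ ℕ λ N → ⟦ φ ⟧ (N ∷ᵛ ν) σ
  ⟦ ∀ᴬ φ ⟧ ν σ      = ∀ x → ⟦ φ ⟧ ν (x ∷ᵛ σ)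
  ⟦ ∃ᴬ φ ⟧ ν σ      = Σ Carrier λ x → ⟦ φ ⟧ ν (x ∷ᵛ σ)

  private variable k l n : ℕ

  block : Fin m → Fin (m + n)
  block {n} i = i ↑ˡ n

  extend : (Fin l → Fin m → Fin n) → Fin (suc l) → Fin m → Fin (m + n)
  extend w zero    = block
  extend w (suc j) = λ i → m ↑ʳ w j i

  small : Fin n → Formula (m + n)
  small N = ⋀ m (λ i → block i ≤ᶠ (m ↑ʳ N))

  -- A variable of the structure becomes `m` number variables, and its quantifiers become blocks
  -- relativised to `Dom`. The norm atom asks for an equivalent tuple with small entries.
  translate : Formula₂ k l → (Fin k → Fin n) → (Fin l → Fin m → Fin n) → Formula n
  translate (x ≐₂ y ⊕₂ z) u w = rename (w x ++ (w y ++ w z)) FunPlus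
  translate (∥ x ∥≤ N)  u w = ∃ⁿ m (small (u N) ∧ᶠ (rename block Dom ∧ᶠ rename (block ++ (λ i → m ↑ʳ w x i)) PredEq))
  translate (M <₂ N)    u w = ¬ᶠ (u N ≤ᶠ u M)
  translate (¬₂ φ)      u w = ¬ᶠ translate φ u w
  translate (φ ∧₂ ψ)    u w = translate φ u w ∧ᶠ translate ψ u w
  translate (φ ⇒₂ ψ)    u w = ¬ᶠ (translate φ u w ∧ᶠ (¬ᶠ translate ψ u w))
  translate (∀ᴺ φ)      u w = ∀ᶠ (translate φ (lift u) (λ j i → suc (w j i)))
  translate (∃ᴺ φ)      u w = ∃ᶠ (translate φ (lift u) (λ j i → suc (w j i)))
  translate (∀ᴬ φ)      u w = ¬ᶠ (∃ⁿ m (rename block Dom ∧ᶠ (¬ᶠ translate φ (λ j → m ↑ʳ u j) (extend w))))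
  translate (∃ᴬ φ)      u w = ∃ⁿ m (rename block Dom ∧ᶠ translate φ (λ j → m ↑ʳ u j) (extend w))

  -- ρ encodes the assignment (ν , σ), the variables being located at u and w.
  record Encodes (ρ : Vector ℕ n) (u : Fin k → Fin n) (w : Fin l → Fin m → Fin n)
                 (ν : Vector ℕ k) (σ : Vector Carrier l) : Set where
    constructor encodes
    field
      nat : ∀ j → ρ (u j) ≡ ν j
      rep : ∀ j → Rep (ρ ∘ w j) (σ j)

  open Encodes

  private variable
    ρ : Vector ℕ n
    u : Fin k → Fin n
    w : Fin l → Fin m → Fin n
    ν : Vector ℕ k
    σ : Vector Carrier l

  encode-ℕ : ∀ N → Encodes ρ u w ν σ → Encodes (N ∷ᵛ ρ) (lift u) (λ j i → suc (w j i)) (N ∷ᵛ ν) σ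
  encode-ℕ N e = encodes (λ { zero → refl ; (suc j) → nat e j }) (rep e)

  encode-A : ∀ {b x} → Rep b x → Encodes ρ u w ν σ →
             Encodes (b ++ ρ) (λ j → m ↑ʳ u j) (extend w) ν (x ∷ᵛ σ)
  encode-A {ρ = ρ} {w = w} {b = b} p e = encodes (λ j → trans (lookup-++ʳ b ρ _) (nat e j)) λ
    { zero    → Rep-cong (λ i → sym (lookup-++ˡ b ρ i)) p
    ; (suc j) → Rep-cong (λ i → sym (lookup-++ʳ b ρ (w j i))) (rep e j) }

  sat-Dom : ∀ {b} {ρ : Vector ℕ n} → D b ⇔ ℕ-str ⊨ rename block Dom [ b ++ ρ ]
  sat-Dom {b = b} {ρ} = mk⇔
    (λ d → from (sat-rename block Dom (b ++ ρ)) (sat-cong Dom (λ i → sym (lookup-++ˡ b ρ i)) d))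
    (λ p → sat-cong Dom (lookup-++ˡ b ρ) (to (sat-rename block Dom (b ++ ρ)) p))

  sat-small : ∀ {b} {ρ : Vector ℕ n} {N} → (∀ i → b i ≤ ρ N) ⇔ ℕ-str ⊨ small N [ b ++ ρ ]
  sat-small {b = b} {ρ} {N} = mk⇔
    (λ p → from (sat-⋀ m _ (b ++ ρ)) λ i → from (sat-≤ᶠ (block i) (m ↑ʳ N) (b ++ ρ))
      (subst₂ _≤_ (sym (lookup-++ˡ b ρ i)) (sym (lookup-++ʳ b ρ N)) (p i)))
    (λ p i → subst₂ _≤_ (lookup-++ˡ b ρ i) (lookup-++ʳ b ρ N)
      (to (sat-≤ᶠ (block i) (m ↑ʳ N) (b ++ ρ)) (to (sat-⋀ m _ (b ++ ρ)) p i)))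

  -- The classical encodings of implication and of the quantifiers are faithful because `sat?`
  -- decides Presburger formulas.
  sat-translate : (φ : Formula₂ k l) → Encodes ρ u w ν σ → ⟦ φ ⟧ ν σ ⇔ ℕ-str ⊨ translate φ u w [ ρ ]
  sat-translate {ρ = ρ} {w = w} (x ≐₂ y ⊕₂ z) e = mk⇔
    (λ p → from (sat-rename locations FunPlus ρ) (sat-cong FunPlus together (to sum p)))
    (λ p → from sum (sat-cong FunPlus (sym ∘ together) (to (sat-rename locations FunPlus ρ) p)))
    where
    locations = w x ++ (w y ++ w z)
    sum = Rep-⊕ (rep e x) (rep e y) (rep e z)
    together : (ρ ∘ w x) ++ ((ρ ∘ w y) ++ (ρ ∘ w z)) ≗ ρ ∘ locations
    together i = trans (++-cong (ρ ∘ w x) (ρ ∘ w x) (λ _ → refl) (∘-++ ρ (w y) (w z)) i)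
                       (∘-++ ρ (w x) (w y ++ w z) i)
  sat-translate {ρ = ρ} {u = u} {w = w} {ν = ν} (∥ x ∥≤ N) e = mk⇔
    (λ (b , b≤ , d , eq) → from (sat-∃ⁿ m body ρ) (b
      , to sat-small (λ i → subst (b i ≤_) (sym (nat e N)) (b≤ i))
      , to sat-Dom d
      , from (sat-rename locations PredEq (b ++ ρ))
          (sat-cong PredEq (together b) (to (Rep-∼ (d , refl) (rep e x)) eq))))
    (λ p → let b , s , d , q = to (sat-∃ⁿ m body ρ) p in b
      , (λ i → subst (b i ≤_) (nat e N) (from sat-small s i))
      , from sat-Dom d
      , from (Rep-∼ (from sat-Dom d , refl) (rep e x))
          (sat-cong PredEq (sym ∘ together b) (to (sat-rename locations PredEq (b ++ ρ)) q)))
    where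
    locations = block ++ (λ i → m ↑ʳ w x i)
    body = small (u N) ∧ᶠ (rename block Dom ∧ᶠ rename locations PredEq)
    together : ∀ b → b ++ (ρ ∘ w x) ≗ (b ++ ρ) ∘ locations
    together b i = trans
      (++-cong b ((b ++ ρ) ∘ block) (λ j → sym (lookup-++ˡ b ρ j)) (λ j → sym (lookup-++ʳ b ρ (w x j))) i)
      (∘-++ (b ++ ρ) block (λ i → m ↑ʳ w x i) i)
  sat-translate {ρ = ρ} {u = u} (M <₂ N) e = mk⇔
    (λ p q → <⇒≱ p (subst₂ _≤_ (nat e N) (nat e M) (to (sat-≤ᶠ (u N) (u M) ρ) q)))
    (λ p → ≰⇒> λ q → p (from (sat-≤ᶠ (u N) (u M) ρ) (subst₂ _≤_ (sym (nat e N)) (sym (nat e M)) q)))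
  sat-translate (¬₂ φ) e = let E = sat-translate φ e in mk⇔ (_∘ from E) (_∘ to E)
  sat-translate (φ ∧₂ ψ) e = let E = sat-translate φ e ; E' = sat-translate ψ e in
    mk⇔ (λ (p , q) → to E p , to E' q) (λ (p , q) → from E p , from E' q)
  sat-translate {ρ = ρ} {u = u} {w = w} (φ ⇒₂ ψ) e = let E = sat-translate φ e ; E' = sat-translate ψ e in
    mk⇔ (λ f (p , ¬q) → ¬q (to E' (f (from E p))))
        (λ f p → from E' (decidable-stable (sat? (translate ψ u w) ρ) λ ¬q → f (to E p , ¬q)))
  sat-translate (∀ᴺ φ) e = mk⇔
    (λ f N → to (sat-translate φ (encode-ℕ N e)) (f N))
    (λ f N → from (sat-translate φ (encode-ℕ N e)) (f N))
  sat-translate {ρ = ρ} (∃ᴺ φ) e = mk⇔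
    (λ (N , p) ∀¬ → ∀¬ N (to (sat-translate φ (encode-ℕ N e)) p))
    (λ p → let N , q = ∃ᶠ⇒Σ _ ρ p in N , from (sat-translate φ (encode-ℕ N e)) q)
  sat-translate {ρ = ρ} {u = u} {w = w} (∀ᴬ φ) e = mk⇔
    (λ f p → let b , d , ¬q = to (sat-∃ⁿ m body ρ) p
             in ¬q (to (sat-translate φ (encode-A (from sat-Dom d , refl) e)) (f _)))
    (λ f x → let b , r = representative x ; E = sat-translate φ (encode-A r e)
             in from E (decidable-stable (sat? (translate φ (λ j → m ↑ʳ u j) (extend w)) (b ++ ρ)) λ ¬q →
                  f (from (sat-∃ⁿ m body ρ) (b , to sat-Dom (proj₁ r) , ¬q))))
    where body = rename block Dom ∧ᶠ (¬ᶠ translate φ (λ j → m ↑ʳ u j) (extend w))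
  sat-translate {ρ = ρ} {u = u} {w = w} (∃ᴬ φ) e = mk⇔
    (λ (x , p) → let b , r = representative x
                 in from (sat-∃ⁿ m body ρ) (b , to sat-Dom (proj₁ r) , to (sat-translate φ (encode-A r e)) p))
    (λ p → let b , d , q = to (sat-∃ⁿ m body ρ) p
           in _ , from (sat-translate φ (encode-A (from sat-Dom d , refl) e)) q)
    where body = rename block Dom ∧ᶠ translate φ (λ j → m ↑ʳ u j) (extend w)

  module _ {k l} (ν : Vector ℕ k) (σ : Vector Carrier l) where

    parameters : Vector ℕ (l * m)
    parameters i = let j , i' = remQuot {l} m i in proj₁ (representative (σ j)) i'

    encoding : Encodes (ν ++ parameters) (_↑ˡ (l * m)) (λ j i → k ↑ʳ combine j i) ν σ
    encoding = encodes (lookup-++ˡ ν parameters) λ j → Rep-cong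
      (λ i → sym (trans (lookup-++ʳ ν parameters (combine j i))
        (cong (λ (j' , i') → proj₁ (representative (σ j')) i') (remQuot-combine j i))))
      (proj₂ (representative (σ j)))

  abstract

    -- With representatives as parameters the formula becomes a Presburger formula. This is what
    -- allows classical case distinctions on definable properties of the structure.
    holds? : (φ : Formula₂ k l) (ν : Vector ℕ k) (σ : Vector Carrier l) → Dec (⟦ φ ⟧ ν σ)
    holds? φ ν σ = let E = sat-translate φ (encoding ν σ) in map′ (from E) (to E) (sat? _ _)

    periodic₂ : (φ : Formula₂ 1 l) (σ : Vector Carrier l) → Periodic (λ N → ⟦ φ ⟧ (N ∷ᵛ []ᵛ) σ)
    periodic₂ {l} φ σ = record
      { Periodic P
      ; shift = λ N le → mk⇔
          (λ p → from (E (N + P.period)) (to (P.shift N le) (to (E N) p)))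
          (λ p → from (E N) (from (P.shift N le) (to (E (N + P.period)) p))) }
      where
      τ : Vector ℕ (l * m)
      τ = []ᵛ ++ parameters []ᵛ σ
      ψ : Formula (suc (l * m))
      ψ = translate φ (lift (_↑ˡ (l * m))) (λ j i → suc (0 ↑ʳ combine j i))
      E : ∀ N → ⟦ φ ⟧ (N ∷ᵛ []ᵛ) σ ⇔ ℕ-str ⊨ ψ [ N ∷ᵛ τ ]
      E N = sat-translate φ (encode-ℕ N (encoding []ᵛ σ))
      P : Periodic (λ N → ℕ-str ⊨ ψ [ N ∷ᵛ τ ])
      P = periodic ψ τ
      module P = Periodic P

    -- The parameters are fixed, so the bound of `bounded-witness` is linear in `N` alone. A mere
    -- existence statement, uniform in `N`, thereby acquires a linear rate.
    linear-witness : (φ : Formula₂ 2 l) (σ : Vector Carrier l) →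
                     (∀ N → Σ ℕ λ M → ⟦ φ ⟧ (M ∷ᵛ N ∷ᵛ []ᵛ) σ) →
                     Σ ℕ λ C → ∀ N → .{{_ : NonZero N}} → Σ ℕ λ M → M ≤ C * N × ⟦ φ ⟧ (M ∷ᵛ N ∷ᵛ []ᵛ) σ
    -- As `N` is at least 1, one copy of `B + B * S` absorbs the constant part of the bound and the
    -- other the part `B * N`.
    linear-witness {l} φ σ f = B + B * S + (B + B * S) , λ N →
        let M , p = f N
            E M = sat-translate φ (encode-ℕ M (encode-ℕ N (encoding []ᵛ σ)))
            M' , M'≤ , q = bounded-witness ψ (N ∷ᵛ τ) M (to (E M) p)
        in M' , ≤-trans M'≤ (estimate N) , from (E M') q
      where
      τ : Vector ℕ (l * m)
      τ = []ᵛ ++ parameters []ᵛ σ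
      ψ : Formula (suc (suc (l * m)))
      ψ = translate φ (lift (lift (_↑ˡ (l * m)))) (λ j i → suc (suc (0 ↑ʳ combine j i)))
      B S : ℕ
      B = search-bound ψ
      S = sumᵛ τ
      estimate : ∀ N → .{{_ : NonZero N}} → B + B * (N + S) ≤ (B + B * S + (B + B * S)) * N
      estimate N = begin
        B + B * (N + S)                       ≡⟨ eq B N S ⟩
        (B + B * S) + B * N                   ≤⟨ +-mono-≤ (m≤m*n (B + B * S) N) (*-monoˡ-≤ N (m≤m+n B (B * S))) ⟩
        (B + B * S) * N + (B + B * S) * N     ≡⟨ *-distribʳ-+ N (B + B * S) _ ⟨
        (B + B * S + (B + B * S)) * N ∎
        where
        open ≤-Reasoning
        eq : ∀ B N S → B + B * (N + S) ≡ (B + B * S) + B * N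
        eq = solve-∀

  elements : List (Vector ℕ m) → List Carrier
  elements []       = []
  elements (b ∷ bs) with sat? Dom b
  ... | yes d = h b d ∷ elements bs
  ... | no _  = elements bs

  length-elements : ∀ bs → length (elements bs) ≤ length bs
  length-elements []       = ≤-refl
  length-elements (b ∷ bs) with sat? Dom b
  ... | yes d = s≤s (length-elements bs)
  ... | no _  = m≤n⇒m≤1+n (length-elements bs)

  ∈-elements : ∀ {b x} bs → b ∈ bs → Rep b x → x ∈ elements bs
  ∈-elements (b ∷ bs) (here refl) (d , refl) with sat? Dom b
  ... | yes d' = here (from (h-kernel b b d d') (∼-refl b d))
  ... | no ¬d  = contradiction d ¬d
  ∈-elements (b ∷ bs) (there b∈) r with sat? Dom b
  ... | yes _ = there (∈-elements bs b∈ r)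
  ... | no _  = ∈-elements bs b∈ r

  -- Elements may be repeated, once for each small representative; only the polynomial bound on the
  -- length matters.
  ball : ℕ → List Carrier
  ball R = elements (vectors (upTo (suc R)) m)

  length-ball : ∀ R → length (ball R) ≤ suc R ^ m
  length-ball R = ≤-trans (length-elements (vectors (upTo (suc R)) m))
    (≤-reflexive (trans (length-vectors (upTo (suc R)) m) (cong (_^ m) (length-upTo (suc R)))))

  ∈-ball : ∀ {x R} → Norm≤ x R → x ∈ ball R
  ∈-ball {R = R} (b , b≤ , r) =
    let g , g∈ , b≗g = vectors-complete (upTo (suc R)) b (λ i → ∈-upTo⁺ (s≤s (b≤ i)))
    in ∈-elements (vectors (upTo (suc R)) m) g∈ (Rep-cong b≗g r)

  Norm≤-mono : ∀ {x M N} → M ≤ N → Norm≤ x M → Norm≤ x N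
  Norm≤-mono M≤N (b , b≤ , r) = b , (λ i → ≤-trans (b≤ i) M≤N) , r

  norm : ∀ x → Σ ℕ (Norm≤ x)
  norm x = let b , r = representative x in sumᵛ b , b , component≤sum b , r
    where
    component≤sum : ∀ {n} (b : Vector ℕ n) i → b i ≤ sumᵛ b
    component≤sum b zero    = m≤m+n (b zero) _
    component≤sum b (suc i) = ≤-trans (component≤sum (b ∘ suc) i) (m≤n+m _ (b zero))

-- Ordered arithmetic in models of Presburger arithmetic.

module Arithmetic where

  open import Algebra.Bundles using (CommutativeMonoid)
  import Algebra.Properties.CommutativeMonoid.Mult as Mult
  import Algebra.Solver.CommutativeMonoid as Solver
  open import Data.Nat as ℕ using (zero; suc; z≤n; s≤s)
  open import Data.Product using (Σ; _,_; proj₁; proj₂)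
  open import Data.Sum using (_⊎_; inj₁; inj₂)
  open import Level using (0ℓ)
  open import Relation.Nullary using (¬_; Dec; yes; no; contradiction)
  open import Relation.Binary.PropositionalEquality

  -- The fragment of Presburger arithmetic on which the argument runs: a cancellative commutative
  -- monoid, linearly and discretely ordered by addition, with division by two.
  record PresburgerMonoid (𝔄 : Structure) : Set where
    open Structure 𝔄
    field
      _≟_       : (x y : Carrier) → Dec (x ≡ y)
      0ᴬ 1ᴬ     : Carrier
      ⊕-comm    : ∀ x y → x ⊕ y ≡ y ⊕ x
      ⊕-assoc   : ∀ x y z → (x ⊕ y) ⊕ z ≡ x ⊕ (y ⊕ z)
      ⊕-idˡ     : ∀ x → 0ᴬ ⊕ x ≡ x
      ⊕-cancelˡ : ∀ x {y z} → x ⊕ y ≡ x ⊕ z → y ≡ z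
      conical   : ∀ x y → x ⊕ y ≡ 0ᴬ → x ≡ 0ᴬ
      total     : ∀ x y → (Σ Carrier λ z → y ≡ x ⊕ z) ⊎ (Σ Carrier λ z → x ≡ y ⊕ z)
      1≢0       : ¬ 1ᴬ ≡ 0ᴬ
      discrete  : ∀ x → ¬ x ≡ 0ᴬ → Σ Carrier λ y → x ≡ 1ᴬ ⊕ y
      halve     : ∀ x → Σ Carrier λ y → x ≡ y ⊕ y ⊎ x ≡ (y ⊕ y) ⊕ 1ᴬ

    ⊕-idʳ : ∀ x → x ⊕ 0ᴬ ≡ x
    ⊕-idʳ x = trans (⊕-comm x 0ᴬ) (⊕-idˡ x)

    commutativeMonoid : CommutativeMonoid 0ℓ 0ℓ
    commutativeMonoid = record
      { Carrier = Carrier ; _≈_ = _≡_ ; _∙_ = _⊕_ ; ε = 0ᴬ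
      ; isCommutativeMonoid = record
        { isMonoid = record
          { isSemigroup = record
            { isMagma = record { isEquivalence = isEquivalence ; ∙-cong = cong₂ _⊕_ }
            ; assoc = ⊕-assoc }
          ; identity = ⊕-idˡ , ⊕-idʳ }
        ; comm = ⊕-comm } }

    open Mult commutativeMonoid public
      using () renaming (_×_ to _·_; ×-homo-+ to ·-homo-+; ×-assocˡ to ·-assoc)
    open Solver commutativeMonoid public
      using (solve; _⊜_) renaming (_⊕_ to _∙_)

    infix 4 _≤_

    _≤_ : Carrier → Carrier → Set
    x ≤ y = Σ Carrier λ z → y ≡ x ⊕ z

    ≤-reflexive : ∀ {x y} → x ≡ y → x ≤ y
    ≤-reflexive {x} refl = 0ᴬ , sym (⊕-idʳ x)

    ≤-refl : ∀ {x} → x ≤ x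
    ≤-refl = ≤-reflexive refl

    ≤-trans : ∀ {x y z} → x ≤ y → y ≤ z → x ≤ z
    ≤-trans {x} (u , refl) (v , refl) = u ⊕ v , ⊕-assoc x u v

    ≤-antisym : ∀ {x y} → x ≤ y → y ≤ x → x ≡ y
    ≤-antisym {x} (u , refl) (v , eq) = sym (trans (cong (x ⊕_) u≡0) (⊕-idʳ x))
      where u≡0 : u ≡ 0ᴬ
            u≡0 = conical u v (sym (⊕-cancelˡ x (trans (⊕-idʳ x) (trans eq (⊕-assoc x u v)))))

    ≤-total : ∀ x y → x ≤ y ⊎ y ≤ x
    ≤-total = total

    0≤ : ∀ x → 0ᴬ ≤ x
    0≤ x = x , sym (⊕-idˡ x)

    x≤x⊕y : ∀ x y → x ≤ x ⊕ y
    x≤x⊕y x y = y , refl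

    y≤x⊕y : ∀ x y → y ≤ x ⊕ y
    y≤x⊕y x y = x , ⊕-comm x y

    ⊕-mono : ∀ {x x' y y'} → x ≤ x' → y ≤ y' → x ⊕ y ≤ x' ⊕ y'
    ⊕-mono {x} {y = y} (u , refl) (v , refl) = u ⊕ v
      , solve 4 (λ x u y v → (x ∙ u) ∙ (y ∙ v) ⊜ (x ∙ y) ∙ (u ∙ v)) refl x u y v

    ⊕-cancelˡ-≤ : ∀ x {y z} → x ⊕ y ≤ x ⊕ z → y ≤ z
    ⊕-cancelˡ-≤ x {y} (u , eq) = u , ⊕-cancelˡ x (trans eq (⊕-assoc x y u))

    1≤ : ∀ {x} → ¬ x ≡ 0ᴬ → 1ᴬ ≤ x
    1≤ {x} = discrete x

    ≤-or-> : ∀ x y → x ≤ y ⊎ y ⊕ 1ᴬ ≤ x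
    ≤-or-> x y with total x y
    ... | inj₁ x≤y = inj₁ x≤y
    ... | inj₂ (z , refl) with z ≟ 0ᴬ
    ...   | yes refl = inj₁ (≤-reflexive (⊕-idʳ y))
    ...   | no z≢0   = inj₂ (⊕-mono (≤-refl {y}) (1≤ z≢0))

    x⊕1≰x : ∀ x → ¬ x ⊕ 1ᴬ ≤ x
    x⊕1≰x x (u , eq) = 1≢0 (conical 1ᴬ u (sym (⊕-cancelˡ x (trans (⊕-idʳ x) (trans eq (⊕-assoc x 1ᴬ u))))))

    _≤?_ : ∀ x y → Dec (x ≤ y)
    x ≤? y with ≤-or-> x y
    ... | inj₁ x≤y = yes x≤y
    ... | inj₂ y<x = no λ x≤y → x⊕1≰x y (≤-trans y<x x≤y)

    ·-monoʳ : ∀ n {x y} → x ≤ y → n · x ≤ n · y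
    ·-monoʳ zero    x≤y = ≤-refl
    ·-monoʳ (suc n) x≤y = ⊕-mono x≤y (·-monoʳ n x≤y)

    ·-monoˡ : ∀ {k n} x → k ℕ.≤ n → k · x ≤ n · x
    ·-monoˡ x z≤n       = 0≤ _
    ·-monoˡ x (s≤s k≤n) = ⊕-mono ≤-refl (·-monoˡ x k≤n)

    standard-or-≥ : ∀ a n → (Σ ℕ λ k → a ≡ k · 1ᴬ) ⊎ n · 1ᴬ ≤ a
    standard-or-≥ a zero = inj₂ (0≤ a)
    standard-or-≥ a (suc n) with standard-or-≥ a n
    ... | inj₁ std = inj₁ std
    ... | inj₂ (z , refl) with z ≟ 0ᴬ
    ...   | yes refl = inj₁ (n , ⊕-idʳ _)
    ...   | no z≢0   = inj₂ (≤-trans (≤-reflexive (⊕-comm 1ᴬ (n · 1ᴬ))) (⊕-mono (≤-refl {n · 1ᴬ}) (1≤ z≢0)))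

    ·1-injective : ∀ i j → i · 1ᴬ ≡ j · 1ᴬ → i ≡ j
    ·1-injective zero    zero    eq = refl
    ·1-injective zero    (suc j) eq = contradiction (conical 1ᴬ _ (sym eq)) 1≢0
    ·1-injective (suc i) zero    eq = contradiction (conical 1ᴬ _ eq) 1≢0
    ·1-injective (suc i) (suc j) eq = cong suc (·1-injective i j (⊕-cancelˡ 1ᴬ eq))

    standard⇒≅ : (∀ a → Σ ℕ λ k → a ≡ k · 1ᴬ) → 𝔄 ≅ ℕ-str
    standard⇒≅ std = record
      { to      = λ a → proj₁ (std a)
      ; from    = λ k → k · 1ᴬ
      ; from-to = λ a → sym (proj₂ (std a))
      ; to-from = λ k → ·1-injective _ k (sym (proj₂ (std (k · 1ᴬ))))
      ; to-hom  = λ x y → ·1-injective _ _ (trans (sym (proj₂ (std (x ⊕ y))))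
          (trans (cong₂ _⊕_ (proj₂ (std x)) (proj₂ (std y))) (sym (·-homo-+ 1ᴬ (proj₁ (std x)) _)))) }

-- Zero, one, order and halving in an interpreted model.

module Models {m : ℕ} (𝔄 : Structure) (ι : Translation m) (I : IsInterpretation ι 𝔄) (⊨PrA : ModelOfPrA 𝔄) where

  open TwoSorted 𝔄 ι I
  open Arithmetic
  open Structure 𝔄
  open import Data.Empty using (⊥-elim)
  open import Data.Fin using (zero; suc)
  open import Data.Fin.Patterns
  open import Data.Nat as ℕ using (zero; suc)
  import Data.Nat.Properties as ℕ
  open import Data.Product using (Σ; _×_; _,_; proj₁; proj₂)
  open import Data.Sum using (_⊎_; inj₁; inj₂)
  open import Data.Vec.Functional using ([]; _∷_)
  open import Relation.Nullary using (¬_; yes; no; contradiction)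
  open import Relation.Nullary.Decidable using (decidable-stable)
  open import Relation.Binary.PropositionalEquality

  private

    pattern v0 = var 0F
    pattern v1 = var 1F
    pattern v2 = var 2F

    comm : ∀ x y → x ⊕ y ≡ y ⊕ x
    comm x y = ⊨PrA (∀ᶠ (∀ᶠ ((v1 ⊕ₜ v0) ≐ (v0 ⊕ₜ v1)))) ℕ.+-comm x y

    assoc : ∀ x y z → (x ⊕ y) ⊕ z ≡ x ⊕ (y ⊕ z)
    assoc x y z = ⊨PrA (∀ᶠ (∀ᶠ (∀ᶠ (((v2 ⊕ₜ v1) ⊕ₜ v0) ≐ (v2 ⊕ₜ (v1 ⊕ₜ v0)))))) ℕ.+-assoc x y z

    cancelˡ : ∀ x {y z} → x ⊕ y ≡ x ⊕ z → y ≡ z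
    cancelˡ x {y} {z} eq = decidable-stable (y ≟ z) λ y≢z →
      ⊨PrA (∀ᶠ (∀ᶠ (∀ᶠ (¬ᶠ (((v2 ⊕ₜ v1) ≐ (v2 ⊕ₜ v0)) ∧ᶠ (¬ᶠ (v1 ≐ v0)))))))
           (λ x y z (p , ¬q) → ¬q (ℕ.+-cancelˡ-≡ x y z p)) x y z (eq , y≢z)

    -- Zero is not in the signature and is recovered as the idempotent. Truth of an `∃ᶠ` sentence in
    -- `𝔄` is only a negated universal; `holds?` turns it into an actual witness.
    idempotent : Σ Carrier λ z → z ≡ z ⊕ z
    idempotent with holds? (∃ᴬ 0F ≐₂ 0F ⊕₂ 0F) [] []
    ... | yes p = p
    ... | no ¬p = ⊥-elim (⊨PrA (∃ᶠ (v0 ≐ (v0 ⊕ₜ v0))) (λ ∀¬ → ∀¬ 0 refl) (λ x p → ¬p (x , p)))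

    0ᴬ : Carrier
    0ᴬ = proj₁ idempotent

    idempotent⇒0 : ∀ x → x ≡ x ⊕ x → x ≡ 0ᴬ
    idempotent⇒0 x p = cancelˡ x (trans (sym p) (sym (cancelˡ 0ᴬ
      (trans (comm 0ᴬ (x ⊕ 0ᴬ)) (trans (assoc x 0ᴬ 0ᴬ)
        (trans (cong (x ⊕_) (sym (proj₂ idempotent))) (comm x 0ᴬ)))))))

    -- The transferred sentence avoids the constant: if a sum is idempotent, so is its first
    -- summand.
    conical : ∀ x y → x ⊕ y ≡ 0ᴬ → x ≡ 0ᴬ
    conical x y eq = idempotent⇒0 x (decidable-stable (x ≟ (x ⊕ x)) λ ¬p →
      ⊨PrA (∀ᶠ (∀ᶠ (¬ᶠ (((v1 ⊕ₜ v0) ≐ ((v1 ⊕ₜ v0) ⊕ₜ (v1 ⊕ₜ v0))) ∧ᶠ (¬ᶠ (v1 ≐ (v1 ⊕ₜ v1)))))))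
        (λ x y (p , ¬q) → ¬q (in-ℕ x y p)) x y
        (trans eq (trans (proj₂ idempotent) (sym (cong₂ _⊕_ eq eq))) , ¬p))
      where
      in-ℕ : ∀ x y → x ℕ.+ y ≡ (x ℕ.+ y) ℕ.+ (x ℕ.+ y) → x ≡ x ℕ.+ x
      in-ℕ x y p with ℕ.m+n≡0⇒m≡0 x (ℕ.m+n≡0⇒m≡0 (x ℕ.+ y) (trans (sym p) x+y≡0))
        where x+y≡0 : x ℕ.+ y ≡ 0
              x+y≡0 = ℕ.+-cancelˡ-≡ (x ℕ.+ y) _ _ (trans (sym p) (sym (ℕ.+-identityʳ _)))
      ... | refl = refl

    total : ∀ x y → (Σ Carrier λ z → y ≡ x ⊕ z) ⊎ (Σ Carrier λ z → x ≡ y ⊕ z)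
    total x y with holds? (∃ᴬ 2F ≐₂ 1F ⊕₂ 0F) [] (x ∷ y ∷ []) | holds? (∃ᴬ 1F ≐₂ 2F ⊕₂ 0F) [] (x ∷ y ∷ [])
    ... | yes p | _     = inj₁ p
    ... | no _  | yes q = inj₂ q
    ... | no ¬p | no ¬q = ⊥-elim (⊨PrA
          (∀ᶠ (∀ᶠ (¬ᶠ (∀ᶠ (¬ᶠ (v2 ≐ (v1 ⊕ₜ v0))) ∧ᶠ ∀ᶠ (¬ᶠ (v1 ≐ (v2 ⊕ₜ v0)))))))
          in-ℕ x y ((λ z p → ¬q (z , p)) , (λ z p → ¬p (z , p))))
      where
      in-ℕ : ∀ x y → ¬ ((∀ z → ¬ x ≡ y ℕ.+ z) × (∀ z → ¬ y ≡ x ℕ.+ z))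
      in-ℕ x y (f , g) with ℕ.≤-total x y
      ... | inj₁ x≤y = g (y ℕ.∸ x) (sym (ℕ.m+[n∸m]≡n x≤y))
      ... | inj₂ y≤x = f (x ℕ.∸ y) (sym (ℕ.m+[n∸m]≡n y≤x))

    -- Discreteness and halving are put into one formula so that the same element serves as the unit
    -- in both.
    isOneᶠ : Formula 1
    isOneᶠ = (¬ᶠ (v0 ≐ (v0 ⊕ₜ v0)))
          ∧ᶠ (∀ᶠ (¬ᶠ ((¬ᶠ (v0 ≐ (v0 ⊕ₜ v0))) ∧ᶠ ∀ᶠ (¬ᶠ (v1 ≐ (v2 ⊕ₜ v0)))))
          ∧ᶠ  ∀ᶠ (¬ᶠ (∀ᶠ ((¬ᶠ (v1 ≐ (v0 ⊕ₜ v0))) ∧ᶠ (¬ᶠ (v1 ≐ ((v0 ⊕ₜ v0) ⊕ₜ v2)))))))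

    -- The same condition with genuine witnesses. Disjunction is written as an implication, and
    -- `y + y` gets a name because an atom allows one sum only.
    isOne₂ : Formula₂ 0 1
    isOne₂ = ¬₂ 0F ≐₂ 0F ⊕₂ 0F
          ∧₂ (∀ᴬ (¬₂ 0F ≐₂ 0F ⊕₂ 0F ⇒₂ (∃ᴬ 1F ≐₂ 2F ⊕₂ 0F)))
          ∧₂ (∀ᴬ (∃ᴬ (¬₂ 1F ≐₂ 0F ⊕₂ 0F ⇒₂ (∃ᴬ 0F ≐₂ 1F ⊕₂ 1F ∧₂ 2F ≐₂ 0F ⊕₂ 3F))))

    isOne : ∀ o → 𝔄 ⊨ isOneᶠ [ o ∷ [] ] → ⟦ isOne₂ ⟧ [] (o ∷ [])
    isOne o (o≢o⊕o , pred , half) = o≢o⊕o , positive , halved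
      where
      positive : ∀ x → ¬ x ≡ x ⊕ x → Σ Carrier λ y → x ≡ o ⊕ y
      positive x ¬p with holds? (∃ᴬ 1F ≐₂ 2F ⊕₂ 0F) [] (x ∷ o ∷ [])
      ... | yes q = q
      ... | no ¬q = ⊥-elim (pred x (¬p , λ y eq → ¬q (y , eq)))
      halved : ∀ x → Σ Carrier λ y → (¬ x ≡ y ⊕ y → Σ Carrier λ z → z ≡ y ⊕ y × x ≡ z ⊕ o)
      halved x with holds? (∃ᴬ (¬₂ 1F ≐₂ 0F ⊕₂ 0F ⇒₂ (∃ᴬ 0F ≐₂ 1F ⊕₂ 1F ∧₂ 2F ≐₂ 0F ⊕₂ 3F))) [] (x ∷ o ∷ [])
      ... | yes q = q
      ... | no ¬q = ⊥-elim (half x λ y →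
            (λ p → ¬q (y , λ ¬p → contradiction p ¬p)) , (λ p → ¬q (y , λ _ → _ , refl , p)))

    isOne-1 : ℕ-str ⊨ isOneᶠ [ 1 ∷ [] ]
    isOne-1 = (λ ()) , (λ { zero (f , _) → f refl ; (suc x) (_ , g) → g x refl })
            , λ x f → let y , p = half x in proj₂ (f y) (p (proj₁ (f y)))
      where
      half : ∀ x → Σ ℕ λ y → (¬ x ≡ y ℕ.+ y → x ≡ (y ℕ.+ y) ℕ.+ 1)
      half zero = 0 , λ f → ⊥-elim (f refl)
      half (suc zero) = 0 , λ _ → refl
      half (suc (suc x)) with half x
      ... | y , p = suc y , λ f → trans (cong (λ v → suc (suc v)) (p λ eq → f (cong suc (trans (cong suc eq) (sym (ℕ.+-suc y y))))))
                                        (sym (cong (λ v → suc (v ℕ.+ 1)) (ℕ.+-suc y y)))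

    one : Σ Carrier λ o → ⟦ isOne₂ ⟧ [] (o ∷ [])
    one with holds? (∃ᴬ isOne₂) [] []
    ... | yes p = p
    ... | no ¬p = ⊥-elim (⊨PrA (∃ᶠ isOneᶠ) (λ ∀¬ → ∀¬ 1 isOne-1) (λ o p → ¬p (o , isOne o p)))

    1ᴬ : Carrier
    1ᴬ = proj₁ one

    halve : ∀ x → Σ Carrier λ y → x ≡ y ⊕ y ⊎ x ≡ (y ⊕ y) ⊕ 1ᴬ
    halve x with proj₂ (proj₂ (proj₂ one)) x
    ... | y , f with x ≟ (y ⊕ y)
    ... | yes p = y , inj₁ p
    ... | no ¬p with f ¬p
    ... | _ , refl , q = y , inj₂ q

  presburgerMonoid : PresburgerMonoid 𝔄
  presburgerMonoid = record
    { _≟_ = _≟_ ; 0ᴬ = 0ᴬ ; 1ᴬ = 1ᴬ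
    ; ⊕-comm = comm ; ⊕-assoc = assoc
    ; ⊕-idˡ = λ x → sym (cancelˡ 0ᴬ (trans (cong (_⊕ x) (proj₂ idempotent)) (assoc 0ᴬ 0ᴬ x)))
    ; ⊕-cancelˡ = cancelˡ ; conical = conical ; total = total
    ; 1≢0 = λ eq → proj₁ (proj₂ one) (trans eq (trans (proj₂ idempotent) (sym (cong₂ _⊕_ eq eq))))
    ; discrete = λ x x≢0 → proj₁ (proj₂ (proj₂ one)) x (λ p → x≢0 (idempotent⇒0 x p))
    ; halve = halve }

-- Coverings by balls and wide elements.

module Standardness {m : ℕ} (𝔄 : Structure) (ι : Translation m) (I : IsInterpretation ι 𝔄)
                    (A : Arithmetic.PresburgerMonoid 𝔄) where

  open Presburger using (Periodic)
  open Naturals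
  open TwoSorted 𝔄 ι I
  open Structure 𝔄
  open Arithmetic.PresburgerMonoid A
  open import Data.Empty using (⊥; ⊥-elim)
  open import Data.Fin as Fin using (Fin; zero; suc; toℕ)
  import Data.Fin.Properties as Fin
  open import Data.Fin.Patterns
  open import Data.List using (List; []; _∷_; lookup)
  open import Data.List.Membership.Propositional using (_∈_)
  open import Data.List.Relation.Unary.Any as Any using (here; there)
  open import Data.List.Relation.Unary.Any.Properties using (lookup-index)
  open import Data.Nat as ℕ using (zero; suc; _+_; _*_; _^_; _⊔_; NonZero; s≤s)
  import Data.Nat.Properties as ℕ
  open import Data.Product using (Σ; _×_; _,_; proj₁; proj₂)
  open import Data.Sum using (_⊎_; inj₁; inj₂)
  open import Data.Vec.Functional using () renaming (_∷_ to _∷ᵛ_; [] to []ᵛ)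
  open import Relation.Nullary using (¬_; Dec; yes; no; contradiction)
  open import Relation.Nullary.Decidable using (_×-dec_)
  open import Relation.Binary.PropositionalEquality

  list-bound : (P : Carrier → ℕ → Set) → (∀ {x M N} → M ℕ.≤ N → P x M → P x N) →
               (∀ x → Σ ℕ (P x)) → ∀ xs → Σ ℕ λ N → ∀ {x} → x ∈ xs → P x N
  list-bound P mono f []       = 0 , λ ()
  list-bound P mono f (x ∷ xs) =
    let M , p = f x ; N , q = list-bound P mono f xs
    in M ⊔ N , λ { (here refl) → mono (ℕ.m≤m⊔n M N) p ; (there x∈) → mono (ℕ.m≤n⊔m M N) (q x∈) }

  Difference≤ : Carrier → Carrier → ℕ → Set
  Difference≤ y x N = ∀ z → x ≡ y ⊕ z → Norm≤ z N

  -- The ball is finite and, by cancellation, each of its elements has at most one difference with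
  -- `y`; so a maximum exists.
  difference-bound : ∀ y R → Σ ℕ λ N → ∀ x → Norm≤ x R → Difference≤ y x N
  difference-bound y R =
    let N , p = list-bound (Difference≤ y) (λ M≤N p z eq → Norm≤-mono M≤N (p z eq)) bound (ball R)
    in N , λ x x≤R → p (∈-ball x≤R)
    where
    bound : ∀ x → Σ ℕ (Difference≤ y x)
    bound x with y ≤? x
    ... | yes (z , refl) = let N , p = norm z in N , λ z' eq → subst (λ z → Norm≤ z N) (⊕-cancelˡ y eq) p
    ... | no y≰x         = 0 , λ z eq → contradiction (z , eq) y≰x

  differences-bound : ∀ R → Σ ℕ λ N → ∀ x y → Norm≤ x R → Norm≤ y R → Difference≤ y x N
  differences-bound R =
    let N , p = list-bound (λ y N → ∀ x → Norm≤ x R → Difference≤ y x N)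
                  (λ M≤N p x x≤R z eq → Norm≤-mono M≤N (p x x≤R z eq))
                  (λ y → difference-bound y R) (ball R)
    in N , λ x y x≤R y≤R → p (∈-ball y≤R) x x≤R

  no-injection-into-ball : ∀ R → (z : Fin (suc (suc R ^ m)) → Carrier) → (∀ j → Norm≤ (z j) R) →
                           (∀ i j → i Fin.< j → ¬ z i ≡ z j) → ⊥
  no-injection-into-ball R z z≤R z-inj =
    let i , j , i<j , eq = Fin.pigeonhole (s≤s (length-ball R)) (λ j → Any.index (∈-ball (z≤R j)))
    in z-inj i j i<j (trans (lookup-index (∈-ball (z≤R i)))
         (trans (cong (lookup (ball R)) eq) (sym (lookup-index (∈-ball (z≤R j))))))

  private variable k l : ℕ

  _≤₂_ : Fin l → Fin l → Formula₂ k l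
  x ≤₂ y = ∃ᴬ (suc y ≐₂ suc x ⊕₂ 0F)

  -- This and the next formulas unfold definitionally to `Covers`, `Wide`, `IsLeast`, `_⊏_` and
  -- `Record`, so results on two-sorted formulas apply to these notions directly.
  coversᶠ : Fin k → Fin l → Fin l → Formula₂ k l
  coversᶠ R a x = ∀ᴬ (0F ≤₂ suc a ⇒₂ (∃ᴬ (1F ≤₂ 0F ∧₂ (∃ᴬ (0F ≐₂ 2F ⊕₂ suc (suc (suc x)) ∧₂ 1F ≤₂ 0F)) ∧₂ ∥ 0F ∥≤ R)))

  wideᶠ : Fin l → Fin l → Formula₂ k l
  wideᶠ a x = ∃ᴺ coversᶠ 0F a x

  leastᶠ : Fin k → Fin l → Fin l → Formula₂ k l
  leastᶠ N a x = wideᶠ a x ∧₂ ∥ x ∥≤ N ∧₂ (∀ᴬ (wideᶠ (suc a) 0F ⇒₂ (∥ 0F ∥≤ N ⇒₂ suc x ≤₂ 0F)))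

  gapᶠ : Fin l → Fin l → Fin l → Formula₂ k l
  gapᶠ a x y = ∃ᴬ (wideᶠ (suc a) 0F ∧₂ suc y ≐₂ suc x ⊕₂ 0F)

  recordᶠ : Fin k → Fin l → Formula₂ k l
  recordᶠ N a = ∀ᴺ (0F <₂ suc N ⇒₂ (∀ᴬ (∀ᴬ
    (leastᶠ (suc N) (suc (suc a)) 1F ⇒₂ (leastᶠ 0F (suc (suc a)) 0F ⇒₂ gapᶠ (suc (suc a)) 1F 0F)))))

  module _ (a : Carrier) where

    -- The elements of norm at most R meet every interval [ y , y + x ] with y ≤ a; the sum w is
    -- named so that this is ⟦ coversᶠ ⟧ on the nose.
    Covers : ℕ → Carrier → Set
    Covers R x = ∀ y → y ≤ a → Σ Carrier λ z → y ≤ z × (Σ Carrier λ w → w ≡ y ⊕ x × z ≤ w) × Norm≤ z R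

    Wide : Carrier → Set
    Wide x = Σ ℕ λ R → Covers R x

    wide? : ∀ x → Dec (Wide x)
    wide? x = holds? (wideᶠ 0F 1F) []ᵛ (a ∷ᵛ x ∷ᵛ []ᵛ)

    norm≤? : ∀ x N → Dec (Norm≤ x N)
    norm≤? x N = holds? (∥ 0F ∥≤ 0F) (N ∷ᵛ []ᵛ) (x ∷ᵛ []ᵛ)

    covers-≤ : ∀ {R x x'} → x ≤ x' → Covers R x → Covers R x'
    covers-≤ x≤x' c y y≤a =
      let z , y≤z , (w , eq , z≤w) , z≤R = c y y≤a
      in z , y≤z , (_ , refl , ≤-trans z≤w (≤-trans (≤-reflexive eq) (⊕-mono ≤-refl x≤x'))) , z≤R

    -- The intervals [ j (x + 1) , j (x + 1) + x ] are disjoint.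
    covers-length : ∀ R x → Covers R x → ¬ (suc R ^ m) · (1ᴬ ⊕ x) ≤ a
    covers-length R x c large = no-injection-into-ball R z
      (λ j → proj₂ (proj₂ (proj₂ (chosen j)))) distinct
      where
      start : Fin (suc (suc R ^ m)) → Carrier
      start j = toℕ j · (1ᴬ ⊕ x)
      chosen : ∀ j → _
      chosen j = c (start j) (≤-trans (·-monoˡ (1ᴬ ⊕ x) (ℕ.≤-pred (Fin.toℕ<n j))) large)
      z : Fin (suc (suc R ^ m)) → Carrier
      z j = proj₁ (chosen j)
      distinct : ∀ i j → i Fin.< j → ¬ z i ≡ z j
      distinct i j i<j eq =
        let _ , _ , (w , w≡ , zi≤w) , _ = chosen i
            _ , start≤zj , _ = chosen j
        in x⊕1≰x (start i ⊕ x) (≤-trans (≤-reflexive (solve 3 (λ o x s → (s ∙ x) ∙ o ⊜ (o ∙ x) ∙ s) refl 1ᴬ x (start i)))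
             (≤-trans (·-monoˡ (1ᴬ ⊕ x) i<j) (≤-trans start≤zj
               (≤-trans (≤-reflexive (sym eq)) (≤-trans zi≤w (≤-reflexive w≡))))))

    -- For gap 0 the intervals in `covers-length` are single points, so `a` lies below the size
    -- bound of a ball and is reached by counting.
    wide-0⇒standard : Wide 0ᴬ → Σ ℕ λ k → a ≡ k · 1ᴬ
    wide-0⇒standard (R , c) with standard-or-≥ a (suc R ^ m)
    ... | inj₁ std   = std
    ... | inj₂ large = ⊥-elim (covers-length R 0ᴬ c
            (subst (λ x → (suc R ^ m) · x ≤ a) (sym (⊕-idʳ 1ᴬ)) large))

    wide-a : Wide a
    wide-a = let N , p = norm a in N , λ y y≤a → a , y≤a , (_ , refl , y≤x⊕y y a) , p

    wide-≤ : ∀ {x x'} → x ≤ x' → Wide x → Wide x'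
    wide-≤ x≤x' (R , c) = R , covers-≤ x≤x' c

    -- A point of [ y₀ , y₀ + 2 y + 1 ] lies in [ y₀ , y₀ + y ], possibly after subtracting y + 1.
    wide-half : ∀ y → Wide (y ⊕ (y ⊕ 1ᴬ)) → Wide y
    wide-half y (R , c) = R ⊔ proj₁ D , cover
      where
      D = difference-bound (y ⊕ 1ᴬ) R
      cover : Covers (R ⊔ proj₁ D) y
      cover y₀ y₀≤a with c y₀ y₀≤a
      ... | z , y₀≤z , (w , w≡ , z≤w) , z≤R with ≤-or-> z (y₀ ⊕ y)
      ... | inj₁ z≤ = z , y₀≤z , (_ , refl , z≤) , Norm≤-mono (ℕ.m≤m⊔n R _) z≤R
      ... | inj₂ (v , refl) = y₀ ⊕ v , x≤x⊕y y₀ v , (_ , refl , ⊕-mono ≤-refl v≤y)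
            , Norm≤-mono (ℕ.m≤n⊔m R _) (proj₂ D _ z≤R (y₀ ⊕ v)
                (solve 4 (λ y o y₀ v → ((y₀ ∙ y) ∙ o) ∙ v ⊜ (y ∙ o) ∙ (y₀ ∙ v)) refl y 1ᴬ y₀ v))
        where
        v≤y : v ≤ y
        v≤y = ⊕-cancelˡ-≤ ((y₀ ⊕ y) ⊕ 1ᴬ) (≤-trans z≤w (≤-reflexive (trans w≡
          (solve 3 (λ y o y₀ → y₀ ∙ (y ∙ (y ∙ o)) ⊜ ((y₀ ∙ y) ∙ o) ∙ y) refl y 1ᴬ y₀))))

    -- The sum is at most twice the larger summand, so `wide-half` applies. In other words, the
    -- elements that are not wide form an initial segment closed under addition.
    wide-⊕ : ∀ x y → Wide (x ⊕ y) → Wide x ⊎ Wide y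
    wide-⊕ x y wide with ≤-total x y
    ... | inj₁ x≤y = inj₂ (wide-half y (wide-≤ (⊕-mono x≤y (x≤x⊕y y 1ᴬ)) wide))
    ... | inj₂ y≤x = inj₁ (wide-half x (wide-≤ (⊕-mono ≤-refl (≤-trans y≤x (x≤x⊕y x 1ᴬ))) wide))

    -- Wide gaps, records and the function `f`.

    IsLeast : ℕ → Carrier → Set
    IsLeast N x = Wide x × Norm≤ x N × (∀ z → Wide z → Norm≤ z N → x ≤ z)

    _⊏_ : Carrier → Carrier → Set
    x ⊏ y = Σ Carrier λ u → Wide u × y ≡ x ⊕ u

    _⊏?_ : ∀ x y → Dec (x ⊏ y)
    x ⊏? y = holds? (gapᶠ 0F 1F 2F) []ᵛ (a ∷ᵛ x ∷ᵛ y ∷ᵛ []ᵛ)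

    ≤-⊏ : ∀ {x y z} → x ≤ y → y ⊏ z → x ⊏ z
    ≤-⊏ {x} (v , refl) (u , wide , refl) = v ⊕ u , wide-≤ (y≤x⊕y v u) wide , ⊕-assoc x v u

    -- If `z` falls between `x` and `y`, it splits the wide gap into two summands, one of which is
    -- wide by `wide-⊕`.
    ⊏-cotransitive : ∀ {x y} z → x ⊏ y → x ⊏ z ⊎ z ⊏ y
    ⊏-cotransitive {x} z (u , wide , refl) with total x z
    ... | inj₂ (v , refl) = inj₂ (v ⊕ u , wide-≤ (y≤x⊕y v u) wide , ⊕-assoc z v u)
    ... | inj₁ (v , refl) with ≤-total u v
    ...   | inj₁ u≤v        = inj₁ (v , wide-≤ u≤v wide , refl)
    ...   | inj₂ (w , refl) with wide-⊕ v w wide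
    ...     | inj₁ wide-v = inj₁ (v , wide-v , refl)
    ...     | inj₂ wide-w = inj₂ (w , wide-w , sym (⊕-assoc x v w))

    -- Stated through `IsLeast` instead of `f` in order to be definable; the condition is vacuous at
    -- those `M` for which no wide element has norm at most `M`.
    Record : ℕ → Set
    Record N = ∀ M → M ℕ.< N → ∀ x y → IsLeast N x → IsLeast M y → x ⊏ y

    record-periodic : Periodic Record
    record-periodic = periodic₂ (recordᶠ 0F 0F) (a ∷ᵛ []ᵛ)

    data Minimum (N : ℕ) (xs : List Carrier) : Set where
      minimum : ∀ x → Wide x → x ≤ a → x ≡ a ⊎ Norm≤ x N →
                (∀ {z} → z ∈ xs → Wide z → Norm≤ z N → x ≤ z) → Minimum N xs

    minimise : ∀ N xs → Minimum N xs
    -- The default `a` is wide but may have norm above `N`, whence the alternative in `minimum`; it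
    -- disappears for `N` at least `N₀`.
    minimise N [] = minimum a wide-a ≤-refl (inj₁ refl) λ ()
    minimise N (z ∷ xs) with minimise N xs | wide? z ×-dec norm≤? z N
    ... | minimum x w x≤a n l | no ¬p = minimum x w x≤a n λ
          { (here refl) w' n' → contradiction (w' , n') ¬p ; (there z∈) → l z∈ }
    ... | minimum x w x≤a n l | yes (wz , nz) with ≤-total x z
    ...   | inj₁ x≤z = minimum x w x≤a n λ { (here refl) _ _ → x≤z ; (there z∈) → l z∈ }
    ...   | inj₂ z≤x = minimum z wz (≤-trans z≤x x≤a) (inj₂ nz) λ
            { (here refl) _ _ → ≤-refl ; (there z∈) w' n' → ≤-trans z≤x (l z∈ w' n') }

    N₀ : ℕ
    N₀ = proj₁ (norm a)

    abstract

      f : ℕ → Carrier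
      f N with minimise N (ball N)
      ... | minimum x _ _ _ _ = x

      f-wide : ∀ N → Wide (f N)
      f-wide N with minimise N (ball N)
      ... | minimum _ w _ _ _ = w

      f-≤a : ∀ N → f N ≤ a
      f-≤a N with minimise N (ball N)
      ... | minimum _ _ x≤a _ _ = x≤a

      f-least : ∀ N {z} → Wide z → Norm≤ z N → f N ≤ z
      f-least N w n with minimise N (ball N)
      ... | minimum _ _ _ _ l = l (∈-ball n) w n

      f-norm : ∀ N → f N ≡ a ⊎ Norm≤ (f N) N
      f-norm N with minimise N (ball N)
      ... | minimum _ _ _ n _ = n

    f-norm≤ : ∀ {N} → N₀ ℕ.≤ N → Norm≤ (f N) N
    f-norm≤ {N} N₀≤N with f-norm N
    ... | inj₁ eq = subst (λ x → Norm≤ x N) (sym eq) (Norm≤-mono N₀≤N (proj₂ (norm a)))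
    ... | inj₂ n  = n

    f-isLeast : ∀ {N} → N₀ ℕ.≤ N → IsLeast N (f N)
    f-isLeast {N} N₀≤N = f-wide N , f-norm≤ N₀≤N , λ z → f-least N

    f-antitone : ∀ {M N} → M ℕ.≤ N → f N ≤ f M
    f-antitone {M} {N} M≤N with f-norm M
    ... | inj₁ eq = ≤-trans (f-≤a N) (≤-reflexive (sym eq))
    ... | inj₂ n  = f-least N (f-wide M) (Norm≤-mono M≤N n)

    record⇒⊏ : ∀ {M N} → Record N → N₀ ℕ.≤ M → M ℕ.< N → f N ⊏ f M
    record⇒⊏ r N₀≤M M<N =
      r _ M<N _ _ (f-isLeast (ℕ.≤-trans N₀≤M (ℕ.<⇒≤ M<N))) (f-isLeast N₀≤M)

    -- Decay of `f` when 0 is not wide, and the contradiction.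

    module _ (¬wide-0 : ¬ Wide 0ᴬ) where

      ⊏-irrefl : ∀ {x y} → x ≤ y → ¬ y ⊏ x
      ⊏-irrefl {x} (v , refl) (u , wide , eq) =
        ¬wide-0 (subst Wide (conical u v (⊕-cancelˡ x (sym (trans (⊕-idʳ x) (trans eq
          (solve 3 (λ x v u → (x ∙ v) ∙ u ⊜ x ∙ (u ∙ v)) refl x v u)))))) wide)

      -- By `wide-half` the rounded-down half `y` of `f N` is wide, and so is the remainder of
      -- `f N`. The drop is reached as soon as the norm bound admits `y`.
      f-drops : ∀ N → Σ ℕ λ N' → f N' ⊏ f N
      f-drops N with halve (f N)
      ... | y , eq = N' , ≤-⊏ (f-least N' wide-y y≤N') (y⊏f eq)
        where
        wide-2y+1 : f N ≡ y ⊕ y ⊎ f N ≡ (y ⊕ y) ⊕ 1ᴬ → Wide (y ⊕ (y ⊕ 1ᴬ))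
        wide-2y+1 (inj₁ p) = wide-≤ (⊕-mono ≤-refl (x≤x⊕y y 1ᴬ)) (subst Wide p (f-wide N))
        wide-2y+1 (inj₂ p) = subst Wide (trans p (⊕-assoc y y 1ᴬ)) (f-wide N)
        wide-y : Wide y
        wide-y = wide-half y (wide-2y+1 eq)
        N' = proj₁ (norm y)
        y≤N' = proj₂ (norm y)
        y⊏f : f N ≡ y ⊕ y ⊎ f N ≡ (y ⊕ y) ⊕ 1ᴬ → y ⊏ f N
        y⊏f (inj₁ p) = y , wide-y , p
        y⊏f (inj₂ p) = y ⊕ 1ᴬ , wide-≤ (x≤x⊕y y 1ᴬ) wide-y , trans p (⊕-assoc y y 1ᴬ)

      -- The first `N'` with `f N' ⊏ f N` is a record: an earlier value is not a wide amount below
      -- `f N`, so by cotransitivity it is a wide amount above `f N'`.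
      records-unbounded : ∀ N → N₀ ℕ.≤ N → Σ ℕ λ N' → N ℕ.< N' × Record N'
      records-unbounded N N₀≤N with f-drops N
      ... | K , drop with first (λ K → f K ⊏? f N) K drop
      ... | N' , drop' , earlier = N' , N<N' , is-record
        where
        N<N' : N ℕ.< N'
        N<N' = ℕ.≰⇒> λ N'≤N → ⊏-irrefl (f-antitone N'≤N) drop'
        is-record : Record N'
        is-record M M<N' x y (wx , nx , lx) (wy , ny , ly) with ⊏-cotransitive y drop'
        ... | inj₁ fN'⊏y = ≤-⊏ (lx (f N') (f-wide N') (f-norm≤ (ℕ.≤-trans N₀≤N (ℕ.<⇒≤ N<N')))) fN'⊏y
        ... | inj₂ y⊏fN  = contradiction (≤-⊏ (f-least M wy ny) y⊏fN) (earlier M M<N')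

      record-gaps : Σ ℕ λ p → Σ ℕ λ T → N₀ ℕ.≤ T × (∀ N → T ℕ.≤ N → Σ ℕ λ N' → N ℕ.< N' × N' ℕ.≤ N + p × Record N')
      record-gaps = bounded-gaps record-periodic N₀ records-unbounded

      -- Finiteness of balls gives some bound for each `N`; definability makes it linear.
      linear-differences : Σ ℕ λ C → ∀ N → .{{_ : NonZero N}} → ∀ x y u →
                           Norm≤ x N → Norm≤ y N → y ≡ x ⊕ u → Norm≤ u (C * N)
      linear-differences =
        let C , g = linear-witness
              (∀ᴬ (∀ᴬ (∀ᴬ (∥ 2F ∥≤ 1F ⇒₂ (∥ 1F ∥≤ 1F ⇒₂ (1F ≐₂ 2F ⊕₂ 0F ⇒₂ ∥ 0F ∥≤ 0F)))))) []ᵛ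
              (λ N → let M , p = differences-bound N in M , λ x y u x≤N y≤N → p y x y≤N x≤N u)
        in C , λ N x y u x≤N y≤N eq → let M , M≤ , p = g N in Norm≤-mono M≤ (p x y u x≤N y≤N eq)

      -- Wideness of `f N` gives some radius for each `N`, and again definability makes it linear.
      -- The formula refers to `f N` as the least wide element of norm at most `N`.
      linear-cover : Σ ℕ λ C → ∀ N → .{{_ : NonZero N}} → N₀ ℕ.≤ N → Σ ℕ λ R → R ℕ.≤ C * N × Covers R (f N)
      linear-cover =
        let C , g = linear-witness (∀ᴬ (leastᶠ 1F 1F 0F ⇒₂ coversᶠ 0F 1F 0F)) (a ∷ᵛ []ᵛ)
              (λ N → let R , c = f-wide N in R , λ x (w , n , _) → covers-≤ (f-least N w n) c)
        in C , λ N N₀≤N → let R , R≤ , c = g N in R , R≤ , c (f N) (f-isLeast N₀≤N)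

      -- k records after N, all below 2N, give k gaps of wide elements of norm at most C * (2N).
      descent : Σ ℕ λ c → NonZero c × (∀ k → Σ ℕ λ T → ∀ N → .{{_ : NonZero N}} → T ℕ.≤ N → k · f (c * N) ≤ f N)
      descent with linear-differences | record-gaps
      -- The factor exceeds `2 * C` by one to be nonzero. The threshold `k * p` makes room for `k`
      -- records, each at most `p` after the previous one, up to `N + N`.
      ... | C , differences | p , T , N₀≤T , gaps = suc (C + C) , _ , λ k → T ⊔ k * p , λ N T≤N →
          steps (N + N) (suc (C + C) * N) {{N+N≢0 N}}
            (ℕ.≤-trans (ℕ.≤-reflexive (trans (ℕ.*-distribˡ-+ C N N) (sym (ℕ.*-distribʳ-+ N C C)))) (ℕ.m≤n+m _ N))
            k N (ℕ.≤-trans (ℕ.m≤m⊔n T (k * p)) T≤N)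
            (ℕ.+-monoʳ-≤ N (ℕ.≤-trans (ℕ.m≤n⊔m T (k * p)) T≤N))
        where
        N+N≢0 : ∀ N → .{{_ : NonZero N}} → NonZero (N + N)
        N+N≢0 (suc N) = _
        -- `X` bounds the norms of all the values of `f` involved and `Y` those of their gaps. Both
        -- stay fixed while `N` moves through the records, so the same `f Y` lies below every gap.
        steps : ∀ X Y → .{{_ : NonZero X}} → C * X ℕ.≤ Y → ∀ k N → T ℕ.≤ N → N + k * p ℕ.≤ X → k · f Y ≤ f N
        steps X Y CX≤Y zero    N T≤N _   = 0≤ (f N)
        steps X Y CX≤Y (suc k) N T≤N N≤X with gaps N T≤N
        ... | N' , N<N' , N'≤ , r with record⇒⊏ r (ℕ.≤-trans N₀≤T T≤N) N<N'
        ... | u , wide-u , eq = ≤-trans (⊕-mono fY≤u (steps X Y CX≤Y k N' T≤N' N'+kp≤X))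
                                        (≤-reflexive (trans (⊕-comm u (f N')) (sym eq)))
          where
          T≤N' : T ℕ.≤ N'
          T≤N' = ℕ.≤-trans T≤N (ℕ.<⇒≤ N<N')
          N'+kp≤X : N' + k * p ℕ.≤ X
          N'+kp≤X = ℕ.≤-trans (ℕ.+-monoˡ-≤ (k * p) N'≤) (ℕ.≤-trans (ℕ.≤-reflexive (ℕ.+-assoc N p (k * p))) N≤X)
          fY≤u : f Y ≤ u
          fY≤u = f-least Y wide-u (Norm≤-mono CX≤Y (differences X (f N') (f N) u
            (Norm≤-mono (ℕ.≤-trans (ℕ.m≤m+n N' (k * p)) N'+kp≤X) (f-norm≤ (ℕ.≤-trans N₀≤T T≤N')))
            (Norm≤-mono (ℕ.≤-trans (ℕ.m≤m+n N (p + k * p)) N≤X) (f-norm≤ (ℕ.≤-trans N₀≤T T≤N))) eq))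

      contradictory : ⊥
      contradictory with descent | linear-cover
      ... | c , c≢0 , descend | B , cover = covers-length R (f N) covers (≤-trans fits (f-≤a N₁))
        where
        -- When `N` is multiplied by `c`, the bound on the ball size grows by about `c ^ m`; the
        -- extra factor 2 makes the decay of `f` win exponentially.
        n = 2 * c ^ m
        T = proj₁ (descend n)
        N₁ = suc (T ⊔ N₀)
        -- The part of the size bound that does not depend on the number of iterations; `2 * q`
        -- iterations gain `2 ^ (2 * q)`, which outweighs it.
        q = suc (B * N₁) ^ m
        i = 2 * q
        N = c ^ i * N₁
        c^≢0 : ∀ j → NonZero (c ^ j)
        c^≢0 j = ℕ.m^n≢0 c j {{c≢0}}
        N₁≤ : ∀ j → N₁ ℕ.≤ c ^ j * N₁
        N₁≤ j = ℕ.m≤n*m N₁ (c ^ j) {{c^≢0 j}}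
        T≤ : ∀ j → T ℕ.≤ c ^ j * N₁
        T≤ j = ℕ.≤-trans (ℕ.≤-trans (ℕ.m≤m⊔n T N₀) (ℕ.n≤1+n _)) (N₁≤ j)
        N₀≤N : N₀ ℕ.≤ N
        N₀≤N = ℕ.≤-trans (ℕ.≤-trans (ℕ.m≤n⊔m T N₀) (ℕ.n≤1+n _)) (N₁≤ i)
        nonZero : ∀ j → NonZero (c ^ j * N₁)
        nonZero j = ℕ.m*n≢0 (c ^ j) N₁ {{c^≢0 j}}
        iterate : ∀ j → (n ^ j) · f (c ^ j * N₁) ≤ f N₁
        iterate zero = ≤-reflexive (trans (⊕-idʳ _) (cong f (ℕ.*-identityˡ N₁)))
        iterate (suc j) = ≤-trans (≤-reflexive (begin
            (n * n ^ j) · f (c * c ^ j * N₁)   ≡⟨ cong₂ _·_ (ℕ.*-comm n (n ^ j)) (cong f (ℕ.*-assoc c (c ^ j) N₁)) ⟩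
            (n ^ j * n) · f (c * (c ^ j * N₁)) ≡⟨ ·-assoc _ (n ^ j) n ⟨
            (n ^ j) · (n · f (c * (c ^ j * N₁))) ∎))
          (≤-trans (·-monoʳ (n ^ j) (proj₂ (descend n) (c ^ j * N₁) {{nonZero j}} (T≤ j))) (iterate j))
          where open ≡-Reasoning
        R = proj₁ (cover N {{nonZero i}} N₀≤N)
        R≤ = proj₁ (proj₂ (cover N {{nonZero i}} N₀≤N))
        covers = proj₂ (proj₂ (cover N {{nonZero i}} N₀≤N))
        -- Since 0 is not wide, `f N` is positive, so the interval length `1ᴬ ⊕ f N` is at most
        -- twice `f N`.
        1≤f : 1ᴬ ≤ f N
        1≤f = 1≤ λ eq → ¬wide-0 (subst Wide eq (f-wide N))
        fits : (suc R ^ m) · (1ᴬ ⊕ f N) ≤ f N₁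
        fits = ≤-trans (·-monoʳ (suc R ^ m) (⊕-mono 1≤f (≤-reflexive (sym (⊕-idʳ (f N))))))
          (≤-trans (≤-reflexive (·-assoc (f N) (suc R ^ m) 2))
            (≤-trans (·-monoˡ (f N) (power-estimate m c {{c≢0}} B N₁ R q refl R≤)) (iterate i)))

    standard : Σ ℕ λ k → a ≡ k · 1ᴬ
    standard with wide? 0ᴬ
    ... | yes wide = wide-0⇒standard wide
    ... | no ¬wide = ⊥-elim (contradictory ¬wide)

theorem2 : (m : ℕ) (𝔄 : Structure) → ModelOfPrA 𝔄 → InterpretedIn-ℕ m 𝔄 → 𝔄 ≅ ℕ-str
theorem2 m 𝔄 ⊨PrA (ι , I) = standard⇒≅ (Standardness.standard 𝔄 ι I M)
  where
  M : Arithmetic.PresburgerMonoid 𝔄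
  M = Models.presburgerMonoid 𝔄 ι I ⊨PrA
  open Arithmetic.PresburgerMonoid M using (standard⇒≅)
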